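{- Let $\mathbb V$ be a vector space over $\mathbb R$, let $D\subseteq V$ be a convex subset with more than one element, and let $\mathbb X=\mathcal P_c\mathbb D$ be the convex algebra of nonempty convex subsets of $D$, with carrier $X$. Let $*\notin X$. Each of the following prescriptions defines a one-point extension $\mathbb X_*$ of $\mathbb X$ with carrier $X\cup\{*\}$: (1) $pA+\bar p*=*$ for all $A\in X$, $p\in(0,1)$ (black-hole behaviour). (2) For a nonempty convex subset $C$ of $\mathrm{Vis}(D)$: $*$ imitates $C$ on all of $X$. (3) For an extremal point $w$ of $\mathbb D$: $*$ imitates $\{w\}$ on $X\setminus\{\{w\}\}$, and $\{w\}$ adheres to $*$. (4) For a nonempty convex subset $C$ of $\mathrm{Vis}(D)$ with at least two elements such that $I:=\mathrm{conv}\{A\in X\mid A\text{ does not adhere to }C\}\neq X$, and a prime ideal $P\neq X$ of $\mathbb X$ with $I\subseteq P$: $*$ imitates $C$ on $P$, and every element of $X\setminus P$ adheres to $*$. Assume in addition that $D-D=\{x-y\mid x,y\in D\}$ is linearly bounded. Then every one-point extension of $\mathbb X$ (with new element $*$) is obtained in this way, and each two of these extensions are different: the case among (1)–(4), the point $w$ in case (3), the set $C$ in cases (2) and (4), and the prime ideal $P$ in case (4), are uniquely determined by a given extension.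
   Context: For $p\in[0,1]$ write $\bar p=1-p$. A convex algebra $\mathbb X$ is a set $X$ with an operation $(x_0,\dots,x_n)\mapsto\sum_{i=0}^n p_ix_i$ for every $n\in\mathbb N$ and all $p_0,\dots,p_n\in[0,1]$ with $\sum_i p_i=1$, such that (Projection) $\sum_i p_ix_i=x_j$ if $p_j=1$, and (Barycenter) $\sum_{i=0}^n p_i\big(\sum_{j=0}^m q_{i,j}x_j\big)=\sum_{j=0}^m\big(\sum_{i=0}^n p_iq_{i,j}\big)x_j$. It is determined by its binary operations $px+\bar py$, $p\in(0,1)$. Homomorphisms are maps preserving all these operations. A convex subset of a real vector space is a convex algebra with the inherited operations. A subset of a convex algebra is convex if it is closed under $px+\bar py$, $p\in(0,1)$; $\mathrm{conv}$ denotes convex hull (smallest convex subset containing the given set, here in $\mathbb X$). For a convex algebra $\mathbb Y$, $\mathcal P_c\mathbb Y$ is the convex algebra whose elements are the nonempty convex subsets of $Y$, with $pA+\bar pB=\{pa+\bar pb\mid a\in A,b\in B\}$. In particular $\mathcal P_c\mathbb D$ is a subalgebra of $\mathcal P_c\mathbb V$. A one-point extension of $\mathbb X$ is a convex algebra $\mathbb X_*$ with carrier $X\cup\{*\}$, $*\notin X$, whose operations restricted to $X$ are those of $\mathbb X$; it is determined by the elements $pA+\bar p*$ for $A\in X$, $p\in(0,1)$. In a convex algebra, $x$ adheres to $y$ if $px+\bar py=y$ for all $p\in(0,1)$. For $A\in X$ and $C\in\mathcal P_c\mathbb V$, "$A$ adheres to $C$" is understood in $\mathcal P_c\mathbb V$;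 "$A$ adheres to $*$" is understood in $\mathbb X_*$. For $Q\subseteq X$ and $C\in\mathcal P_c\mathbb V$, "$*$ imitates $C$ on $Q$" means $pA+\bar p*=pA+\bar pC$ for all $A\in Q$, $p\in(0,1)$ (right-hand side computed in $\mathcal P_c\mathbb V$). The visibility hull of a nonempty convex $A\subseteq V$ is $\mathrm{Vis}(A)=\{x\in V\mid \forall a\in A\ \forall p\in(0,1):\ px+\bar pa\in A\}$; it is convex. A subset $P\subseteq X$ is an ideal if $px+\bar py\in P$ for all $x\in P$, $y\in X$, $p\in(0,1)$; it is a prime ideal if moreover $X\setminus P$ is convex. A point $w$ of a convex algebra is extremal if $px+\bar py=w$ with $p\in(0,1)$ implies $x=y=w$. A convex algebra is linearly bounded if every homomorphism from the convex algebra $(0,\infty)\subseteq\mathbb R$ into it is constant. -}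

module Defs where

open import Level using (_⊔_) renaming (suc to lsuc)
open import Algebra.Bundles using (CommutativeRing)
open import Algebra.Module.Bundles using (Module)
open import Algebra.Module.Construct.TensorUnit using (⟨module⟩)
open import Data.Fin.Base using (Fin; zero; suc; combine; remQuot)
open import Data.Fin.Properties using (_≟_; remQuot-combine)
open import Data.Maybe.Base using (just; nothing)
open import Data.Maybe.Relation.Binary.Pointwise using () renaming (setoid to Maybe-setoid)
open import Data.Nat.Base using (ℕ; zero; suc) renaming (_*_ to _ℕ*_)
open import Data.Product.Base using (Σ; ∃; ∃₂; _×_; _,_; proj₁; proj₂)
open import Data.Sum.Base using (inj₁; inj₂)
open import Function.Base using (_∘_; const)
open import Relation.Binary.Bundles using (Setoid)
open import Relation.Binary.Core using (Rel)
open import Relation.Binary.Definitions using (_Respects_; tri<; tri≈; tri>)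
open import Relation.Binary.Structures using (IsStrictTotalOrder)
open import Relation.Binary.PropositionalEquality.Core as ≡ using (_≡_)
open import Relation.Nullary.Decidable.Core using (Dec; yes; no)
open import Relation.Nullary.Negation.Core using (¬_; contradiction)
open import Relation.Unary using (Pred; U; _∈_; _∉_; _⊆_; _≐_)
import Algebra.Properties.AbelianGroup
import Algebra.Properties.CommutativeMonoid.Sum
import Algebra.Properties.Ring
import Algebra.Properties.Semiring.Sum
import Relation.Binary.Construct.On as On
import Relation.Binary.Construct.StrictToNonStrict
import Relation.Binary.Reasoning.Setoid

-- The library has no real numbers.  They are described axiomatically, as a
-- Dedekind complete ordered field; classically this is ℝ up to isomorphism.
record CompleteOrderedField ℓ : Set (lsuc ℓ) where
  infix 4 _<_
  field
    commutativeRing : CommutativeRing ℓ ℓ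
  open CommutativeRing commutativeRing public renaming (Carrier to ℝ)
  field
    _<_                : Rel ℝ ℓ
    isStrictTotalOrder : IsStrictTotalOrder _≈_ _<_
    +-monoˡ-<          : ∀ {x y} z → x < y → x + z < y + z
    *-pos              : ∀ {x y} → 0# < x → 0# < y → 0# < x * y
    0<1                : 0# < 1#
    inverse            : ∀ x → ¬ x ≈ 0# → ∃ λ y → x * y ≈ 1#
  open Relation.Binary.Construct.StrictToNonStrict _≈_ _<_ public using (_≤_)
  field
    supremum : (S : Pred ℝ ℓ) → (∃ λ x → x ∈ S) → (∃ λ u → ∀ {x} → x ∈ S → x ≤ u) →
               ∃ λ s → (∀ {x} → x ∈ S → x ≤ s) ×
                       (∀ u → (∀ {x} → x ∈ S → x ≤ u) → s ≤ u)

VectorSpace : ∀ {ℓ} → CompleteOrderedField ℓ → Set (lsuc ℓ)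
VectorSpace {ℓ} R = Module (CompleteOrderedField.commutativeRing R) ℓ ℓ

record Subset {c e} (S : Setoid c e) s : Set (c ⊔ e ⊔ lsuc s) where
  open Setoid S
  field
    pred : Pred Carrier s
    resp : pred Respects _≈_

open Subset public

module Convexity {ℓ} (R : CompleteOrderedField ℓ) where
  open CompleteOrderedField R hiding (zero)
  open IsStrictTotalOrder isStrictTotalOrder using (compare; irrefl; asym; <-respˡ-≈; <-respʳ-≈)
    renaming (trans to <-trans)
  open Algebra.Properties.Semiring.Sum semiring
  open Algebra.Properties.Ring ring using (-‿distribʳ-*)
  open Relation.Binary.Reasoning.Setoid setoid

  abstract
    ≤-respˡ : ∀ {x y z} → x ≈ y → x ≤ z → y ≤ z
    ≤-respˡ eq (inj₁ lt) = inj₁ (<-respˡ-≈ eq lt)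
    ≤-respˡ eq (inj₂ e)  = inj₂ (trans (sym eq) e)

    ≤-respʳ : ∀ {x y z} → y ≈ z → x ≤ y → x ≤ z
    ≤-respʳ eq (inj₁ lt) = inj₁ (<-respʳ-≈ eq lt)
    ≤-respʳ eq (inj₂ e)  = inj₂ (trans e eq)

    ≤-trans : ∀ {x y z} → x ≤ y → y ≤ z → x ≤ z
    ≤-trans (inj₂ e) q = ≤-respˡ (sym e) q
    ≤-trans p (inj₂ e) = ≤-respʳ e p
    ≤-trans (inj₁ p) (inj₁ q) = inj₁ (<-trans p q)

    ≤-antisym : ∀ {x y} → x ≤ y → y ≤ x → x ≈ y
    ≤-antisym (inj₂ e) _        = e
    ≤-antisym _ (inj₂ e)        = sym e
    ≤-antisym (inj₁ p) (inj₁ q) = contradiction q (asym p)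

    +-monoˡ-≤ : ∀ {x y} z → x ≤ y → x + z ≤ y + z
    +-monoˡ-≤ z (inj₁ p) = inj₁ (+-monoˡ-< z p)
    +-monoˡ-≤ z (inj₂ e) = inj₂ (+-congʳ e)

    y≤x+y : ∀ {x} y → 0# ≤ x → y ≤ x + y
    y≤x+y y p = ≤-respˡ (+-identityˡ y) (+-monoˡ-≤ y p)

    x≤x+y : ∀ x {y} → 0# ≤ y → x ≤ x + y
    x≤x+y x p = ≤-respʳ (+-comm _ _) (y≤x+y x p)

    0≤+ : ∀ {x y} → 0# ≤ x → 0# ≤ y → 0# ≤ x + y
    0≤+ p q = ≤-trans q (y≤x+y _ p)

    0≤* : ∀ {x y} → 0# ≤ x → 0# ≤ y → 0# ≤ x * y
    0≤* (inj₁ p) (inj₁ q) = inj₁ (*-pos p q)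
    0≤* (inj₂ e) _        = inj₂ (sym (trans (*-congʳ (sym e)) (zeroˡ _)))
    0≤* _ (inj₂ e)        = inj₂ (sym (trans (*-congˡ (sym e)) (zeroʳ _)))

    0≤1-x : ∀ {x} → x ≤ 1# → 0# ≤ 1# - x
    0≤1-x {x} p = ≤-respˡ (-‿inverseʳ x) (+-monoˡ-≤ (- x) p)

    x+[1-x]≈1 : ∀ x → x + (1# - x) ≈ 1#
    x+[1-x]≈1 x = begin
      x + (1# - x)    ≈⟨ +-congˡ (+-comm 1# (- x)) ⟩
      x + (- x + 1#)  ≈⟨ +-assoc x (- x) 1# ⟨
      x - x + 1#      ≈⟨ +-congʳ (-‿inverseʳ x) ⟩
      0# + 1#         ≈⟨ +-identityˡ 1# ⟩
      1#              ∎

    0≤sum : ∀ {n} (t : Fin n → ℝ) → (∀ i → 0# ≤ t i) → 0# ≤ sum t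
    0≤sum {zero}  t p = inj₂ refl
    0≤sum {suc n} t p = 0≤+ (p zero) (0≤sum (t ∘ suc) (p ∘ suc))

    term≤sum : ∀ {n} (t : Fin n → ℝ) → (∀ i → 0# ≤ t i) → ∀ i → t i ≤ sum t
    term≤sum t p zero    = x≤x+y _ (0≤sum (t ∘ suc) (p ∘ suc))
    term≤sum t p (suc i) = ≤-trans (term≤sum (t ∘ suc) (p ∘ suc) i) (y≤x+y _ (p zero))

    sum-zero : ∀ {n} (t : Fin n → ℝ) → (∀ i → t i ≈ 0#) → sum t ≈ 0#
    sum-zero {n} t p = trans (sum-cong-≋ p) (sum-replicate-zero n)

    positive-inverse : ∀ {x y} → 0# < x → x * y ≈ 1# → 0# < y
    positive-inverse {x} {y} 0<x xy≈1 with compare 0# y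
    ... | tri< 0<y _ _ = 0<y
    ... | tri≈ _ 0≈y _ =
      contradiction 0<1 (irrefl (trans (sym (zeroʳ x)) (trans (*-congˡ 0≈y) xy≈1)))
    ... | tri> _ _ y<0 = contradiction 0<1 (asym 1<0)
      where
      0<-y : 0# < - y
      0<-y = <-respʳ-≈ (+-identityˡ _) (<-respˡ-≈ (-‿inverseʳ y) (+-monoˡ-< (- y) y<0))
      0<-1 : 0# < - 1#
      0<-1 = <-respʳ-≈ (trans (sym (-‿distribʳ-* x y)) (-‿cong xy≈1)) (*-pos 0<x 0<-y)
      1<0 : 1# < 0#
      1<0 = <-respʳ-≈ (-‿inverseˡ 1#) (<-respˡ-≈ (+-identityˡ 1#) (+-monoˡ-< 1# 0<-1))

  record Weights (n : ℕ) : Set ℓ where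
    field
      w   : Fin (suc n) → ℝ
      0≤w : ∀ i → 0# ≤ w i
      w≤1 : ∀ i → w i ≤ 1#
      Σ≈1 : ∑[ i ≤ n ] w i ≈ 1#

  open Weights public

  mkWeights : ∀ {n} (t : Fin (suc n) → ℝ) → (∀ i → 0# ≤ t i) → ∑[ i ≤ n ] t i ≈ 1# → Weights n
  mkWeights t p e = record
    { w = t ; 0≤w = p ; w≤1 = λ i → ≤-respʳ e (term≤sum t p i) ; Σ≈1 = e }

  abstract
    mix-sum : ∀ {n m} (p : Weights n) (q : Fin (suc n) → Weights m) →
              ∑[ j ≤ m ] ∑[ i ≤ n ] (w p i * w (q i) j) ≈ 1#
    mix-sum {n} {m} p q = begin
      ∑[ j ≤ m ] ∑[ i ≤ n ] (w p i * w (q i) j)  ≈⟨ ∑-comm (λ j i → w p i * w (q i) j) ⟩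
      ∑[ i ≤ n ] ∑[ j ≤ m ] (w p i * w (q i) j)  ≈⟨ sum-cong-≋ (λ i → *-distribˡ-sum (w p i) (w (q i))) ⟨
      ∑[ i ≤ n ] (w p i * ∑[ j ≤ m ] w (q i) j)  ≈⟨ sum-cong-≋ (λ i → *-congˡ {w p i} (Σ≈1 (q i))) ⟩
      ∑[ i ≤ n ] (w p i * 1#)                    ≈⟨ sum-cong-≋ {suc n} (λ i → *-identityʳ (w p i)) ⟩
      ∑[ i ≤ n ] w p i                           ≈⟨ Σ≈1 p ⟩
      1#                                         ∎

    mix-nonneg : ∀ {n m} (p : Weights n) (q : Fin (suc n) → Weights m) j →
                 0# ≤ ∑[ i ≤ n ] (w p i * w (q i) j)
    mix-nonneg p q j = 0≤sum _ (λ i → 0≤* (0≤w p i) (0≤w (q i) j))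

  -- The coefficients Σᵢ pᵢ qᵢⱼ.
  mix : ∀ {n m} → Weights n → (Fin (suc n) → Weights m) → Weights m
  mix {n} {m} p q = mkWeights
    (λ j → ∑[ i ≤ n ] (w p i * w (q i) j)) (mix-nonneg p q) (mix-sum p q)

  -- The open unit interval (0,1).
  record Unit° : Set ℓ where
    field
      value : ℝ
      0<    : 0# < value
      <1    : value < 1#

  open Unit° public

  pairFun : ℝ → Fin 2 → ℝ
  pairFun x zero    = x
  pairFun x (suc _) = 1# - x

  abstract
    pair-nonneg : ∀ {x} → 0# ≤ x → x ≤ 1# → ∀ i → 0# ≤ pairFun x i
    pair-nonneg 0≤x x≤1 zero    = 0≤x
    pair-nonneg 0≤x x≤1 (suc _) = 0≤1-x x≤1

    pair-sum : ∀ x → ∑[ i ≤ 1 ] pairFun x i ≈ 1#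
    pair-sum x = trans (+-congˡ (+-identityʳ _)) (x+[1-x]≈1 x)

  pairWeights : ∀ x → 0# ≤ x → x ≤ 1# → Weights 1
  pairWeights x 0≤x x≤1 = mkWeights (pairFun x) (pair-nonneg 0≤x x≤1) (pair-sum x)

  binary : Unit° → Weights 1
  binary p = pairWeights (value p) (inj₁ (0< p)) (inj₁ (<1 p))

  pair : ∀ {a} {A : Set a} → A → A → Fin 2 → A
  pair x y zero    = x
  pair x y (suc _) = y

  record ConvexStructure {c e} (S : Setoid c e) : Set (ℓ ⊔ c ⊔ e) where
    open Setoid S using (Carrier) renaming (_≈_ to _≋_)
    field
      comb       : ∀ {n} → Weights n → (Fin (suc n) → Carrier) → Carrier
      comb-cong  : ∀ {n} {p q : Weights n} {x y : Fin (suc n) → Carrier} →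
                   (∀ i → w p i ≈ w q i) → (∀ i → x i ≋ y i) → comb p x ≋ comb q y
      projection : ∀ {n} (p : Weights n) (x : Fin (suc n) → Carrier) j →
                   w p j ≈ 1# → comb p x ≋ x j
      barycenter : ∀ {n m} (p : Weights n) (q : Fin (suc n) → Weights m)
                   (x : Fin (suc m) → Carrier) →
                   comb p (λ i → comb (q i) x) ≋ comb (mix p q) x

    infix 6 _+⟨_⟩_
    -- x +⟨ p ⟩ y  is  p x + (1 - p) y.
    _+⟨_⟩_ : Carrier → Unit° → Carrier → Carrier
    x +⟨ p ⟩ y = comb (binary p) (pair x y)

    Adheres : Carrier → Carrier → Set (ℓ ⊔ e)
    Adheres x y = ∀ p → x +⟨ p ⟩ y ≋ y

  record ConvexAlgebra c e : Set (ℓ ⊔ lsuc (c ⊔ e)) where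
    field
      carrier   : Setoid c e
      structure : ConvexStructure carrier
    open Setoid carrier public using (Carrier)
      renaming (_≈_ to _≋_; refl to ≋-refl; sym to ≋-sym; trans to ≋-trans; reflexive to ≋-reflexive)
    open ConvexStructure structure public

    comb-binary : ∀ p x → comb (binary p) x ≋ x zero +⟨ p ⟩ x (suc zero)
    comb-binary p x = comb-cong {y = pair (x zero) (x (suc zero))} (λ _ → refl)
      (λ { zero → ≋-refl ; (suc zero) → ≋-refl })

    +⟨⟩-cong : ∀ {x x′ y y′} p → x ≋ x′ → y ≋ y′ → x +⟨ p ⟩ y ≋ x′ +⟨ p ⟩ y′
    +⟨⟩-cong {x} {x′} {y} {y′} p x≋ y≋ = comb-cong {x = pair x y} {pair x′ y′} (λ _ → refl)
      (λ { zero → x≋ ; (suc _) → y≋ })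

  record Homomorphism {c e c′ e′} (Y : ConvexAlgebra c e) (Z : ConvexAlgebra c′ e′) :
         Set (ℓ ⊔ c ⊔ e ⊔ c′ ⊔ e′) where
    private
      module Y = ConvexAlgebra Y
      module Z = ConvexAlgebra Z
    field
      map      : Y.Carrier → Z.Carrier
      map-cong : ∀ {x y} → x Y.≋ y → map x Z.≋ map y
      map-comb : ∀ {n} (p : Weights n) x → map (Y.comb p x) Z.≋ Z.comb p (map ∘ x)

  δ : ∀ {n} → Fin n → Fin n → ℝ
  δ zero    zero    = 1#
  δ zero    (suc _) = 0#
  δ (suc _) zero    = 0#
  δ (suc i) (suc j) = δ i j

  abstract
    0≤δ : ∀ {n} (i j : Fin n) → 0# ≤ δ i j
    0≤δ zero    zero    = inj₁ 0<1
    0≤δ zero    (suc _) = inj₂ refl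
    0≤δ (suc _) zero    = inj₂ refl
    0≤δ (suc i) (suc j) = 0≤δ i j

    Σδ≈1 : ∀ {n} (i : Fin n) → sum (δ i) ≈ 1#
    Σδ≈1 {suc n} zero = trans (+-congˡ (sum-replicate-zero n)) (+-identityʳ 1#)
    Σδ≈1 (suc i)      = trans (+-identityˡ _) (Σδ≈1 i)

    δᵢᵢ≈1 : ∀ {n} (i : Fin n) → δ i i ≈ 1#
    δᵢᵢ≈1 zero    = refl
    δᵢᵢ≈1 (suc i) = δᵢᵢ≈1 i

  dirac : ∀ {n} → Fin (suc n) → Weights n
  dirac i = mkWeights (δ i) (0≤δ i) (Σδ≈1 i)

  abstract
    sum-δ : ∀ {n} (t : Fin n → ℝ) k → sum (λ i → t i * δ i k) ≈ t k
    sum-δ t zero = begin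
      t zero * 1# + sum (λ i → t (suc i) * 0#)  ≈⟨ +-cong (*-identityʳ _) (sum-zero (λ i → t (suc i) * 0#) (λ i → zeroʳ (t (suc i)))) ⟩
      t zero + 0#                               ≈⟨ +-identityʳ _ ⟩
      t zero                                    ∎
    sum-δ t (suc k) = trans (+-cong (zeroʳ _) (sum-δ (t ∘ suc) k)) (+-identityˡ _)

    normalise : ∀ {n} (t : Fin (suc n) → ℝ) → (∀ i → 0# ≤ t i) →
                Σ (Weights n) λ s → ∀ i → t i ≈ sum t * w s i
    normalise t 0≤t with compare 0# (sum t)
    ... | tri≈ _ 0≈s _ = dirac zero , λ i →
      trans (≤-antisym (≤-respʳ (sym 0≈s) (term≤sum t 0≤t i)) (0≤t i))
            (sym (trans (*-congʳ (sym 0≈s)) (zeroˡ _)))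
    ... | tri> _ ¬e s<0 with 0≤sum t 0≤t
    ...   | inj₁ 0<s = contradiction s<0 (asym 0<s)
    ...   | inj₂ 0≈s = contradiction 0≈s ¬e
    normalise t 0≤t | tri< 0<s ¬e _
      with y , sy≈1 ← inverse (sum t) (¬e ∘ sym) =
      mkWeights (λ i → y * t i)
        (λ i → 0≤* (inj₁ (positive-inverse 0<s sy≈1)) (0≤t i))
        (trans (sym (*-distribˡ-sum y t)) (trans (*-comm _ _) sy≈1)) ,
      λ i → sym (trans (sym (*-assoc _ _ _)) (trans (*-congʳ sy≈1) (*-identityˡ _)))

  module Derived {c e} (Y : ConvexAlgebra c e) where
    open ConvexAlgebra Y

    at-dirac : ∀ {m} (x : Fin (suc m) → Carrier) i → x i ≋ comb (dirac i) x
    at-dirac x i = ≋-sym (projection (dirac i) x i (δᵢᵢ≈1 i))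

    at-diracs : ∀ {n m} (p : Weights n) (f : Fin (suc n) → Fin (suc m)) x →
                comb p (x ∘ f) ≋ comb p (λ i → comb (dirac (f i)) x)
    at-diracs p f x = comb-cong (λ _ → refl) (λ i → at-dirac x (f i))

    reindex : ∀ {n m} (p : Weights n) (f : Fin (suc n) → Fin (suc m)) x →
              comb p (x ∘ f) ≋ comb (mix p (dirac ∘ f)) x
    reindex p f x = ≋-trans (at-diracs p f x) (barycenter p (dirac ∘ f) x)

    -- Two double combinations of the same family with equal coefficients agree.
    interchange : ∀ {n m} (p : Weights n) (q : Fin (suc n) → Weights m)
                  (r : Weights m) (s : Fin (suc m) → Weights n) →
                  (∀ i j → w p i * w (q i) j ≈ w r j * w (s j) i) →
                  (b : Fin (suc n) → Fin (suc m) → Carrier) →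
                  comb p (λ i → comb (q i) (b i)) ≋ comb r (λ j → comb (s j) (λ i → b i j))
    interchange {n} {m} p q r s eq b =
      ≋-trans (comb-cong (λ _ → refl) (λ i → ≋-trans (comb-cong (λ _ → refl) (λ j → b≋ i j))
                                                     (reindex (q i) (combine i) b′)))
      (≋-trans (barycenter p _ b′)
      (≋-trans (comb-cong weights≈ (λ _ → ≋-refl))
      (≋-sym
      (≋-trans (comb-cong (λ _ → refl) (λ j → ≋-trans (comb-cong (λ _ → refl) (λ i → b≋ i j))
                                                      (reindex (s j) (λ i → combine i j) b′)))
               (barycenter r _ b′)))))
      where
      b′ : Fin (suc n ℕ* suc m) → Carrier
      b′ k = b (proj₁ (remQuot {suc n} (suc m) k)) (proj₂ (remQuot {suc n} (suc m) k))
      b≋ : ∀ i j → b i j ≋ b′ (combine i j)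
      b≋ i j = ≋-reflexive (≡.sym (≡.cong (λ ij → b (proj₁ ij) (proj₂ ij)) (remQuot-combine {suc n} {suc m} i j)))
      weights≈ : ∀ k → w (mix p (λ i → mix (q i) (dirac ∘ combine i))) k ≈
                       w (mix r (λ j → mix (s j) (λ i → dirac (combine i j)))) k
      weights≈ k =
        trans (sum-cong-≋ (λ i → *-distribˡ-sum (w p i) (λ j → w (q i) j * d i j)))
        (trans (∑-comm (λ i j → w p i * (w (q i) j * d i j)))
        (trans (sum-cong-≋ (λ j → sum-cong-≋ (λ i → begin
                 w p i * (w (q i) j * d i j)  ≈⟨ *-assoc _ _ _ ⟨
                 w p i * w (q i) j * d i j    ≈⟨ *-congʳ (eq i j) ⟩
                 w r j * w (s j) i * d i j    ≈⟨ *-assoc _ _ _ ⟩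
                 w r j * (w (s j) i * d i j)  ∎)))
               (sym (sum-cong-≋ (λ j → *-distribˡ-sum (w r j) (λ i → w (s j) i * d i j))))))
        where
        d : Fin (suc n) → Fin (suc m) → ℝ
        d i j = δ (combine i j) k

    split : ∀ {n} (p : Weights (suc n)) (s : Weights n) →
            (∀ i → w p (suc i) ≈ (1# - w p zero) * w s i) → ∀ x →
            comb p x ≋ comb (pairWeights (w p zero) (0≤w p zero) (w≤1 p zero))
                            (pair (x zero) (comb s (x ∘ suc)))
    split {n} p s eq x = ≋-sym
      (≋-trans (comb-cong (λ _ → refl) parts)
      (≋-trans (barycenter pw q x)
               (comb-cong weights≈ (λ _ → ≋-refl))))
      where
      pw : Weights 1
      pw = pairWeights (w p zero) (0≤w p zero) (w≤1 p zero)
      q : Fin 2 → Weights (suc n)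
      q = pair (dirac zero) (mix s (dirac ∘ suc))
      parts : ∀ i → pair (x zero) (comb s (x ∘ suc)) i ≋ comb (q i) x
      parts zero    = at-dirac x zero
      parts (suc _) = reindex s suc x
      weights≈ : ∀ k → w (mix pw q) k ≈ w p k
      weights≈ zero = trans
        (+-cong (*-identityʳ _)
          (trans (+-identityʳ _)
          (trans (*-congˡ (sum-zero _ (λ i → zeroʳ (w s i)))) (zeroʳ _))))
        (+-identityʳ _)
      weights≈ (suc k) = trans
        (+-cong (zeroʳ _)
          (trans (+-identityʳ _)
          (trans (*-congˡ (sum-δ (w s) k)) (sym (eq k)))))
        (+-identityˡ _)

    idempotent : ∀ {n} (p : Weights n) x → comb p (const x) ≋ x
    idempotent p x =
      ≋-trans (comb-cong (λ _ → refl) (λ _ → at-dirac (const x) zero))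
      (≋-trans (barycenter p (const one) (const x))
               (projection _ (const x) zero (Σ≈1-mix (mix p (const one)))))
      where
      one : Weights 0
      one = dirac zero
      Σ≈1-mix : (v : Weights 0) → w v zero ≈ 1#
      Σ≈1-mix v = trans (sym (+-identityʳ _)) (Σ≈1 v)

  module _ {c e} (Y : ConvexAlgebra c e) where
    open ConvexAlgebra Y

    IsConvex : ∀ {s} → Subset carrier s → Set _
    IsConvex S = ∀ {x y} p → x ∈ pred S → y ∈ pred S → x +⟨ p ⟩ y ∈ pred S

    -- The smallest convex subset containing S, generated inductively; `incl≋`
    -- makes it a subset of the setoid.
    data Conv {s} (S : Pred Carrier s) : Pred Carrier (ℓ ⊔ c ⊔ e ⊔ s) where
      incl  : ∀ {x} → x ∈ S → x ∈ Conv S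
      incl≋ : ∀ {x y} → x ≋ y → x ∈ Conv S → y ∈ Conv S
      mixed : ∀ {x y} p → x ∈ Conv S → y ∈ Conv S → x +⟨ p ⟩ y ∈ Conv S

    IsIdeal : ∀ {s} → Subset carrier s → Set _
    IsIdeal P = ∀ {x y} p → x ∈ pred P → x +⟨ p ⟩ y ∈ pred P

    complement : ∀ {s} → Subset carrier s → Subset carrier s
    complement P = record
      { pred = _∉ pred P ; resp = λ x≋y x∉P y∈P → x∉P (resp P (≋-sym x≋y) y∈P) }

    IsPrimeIdeal : ∀ {s} → Subset carrier s → Set _
    IsPrimeIdeal P = IsIdeal P × IsConvex (complement P)

    Extremal : Carrier → Set _
    Extremal v = ∀ x y p → x +⟨ p ⟩ y ≋ v → x ≋ v × y ≋ v

    Vis : ∀ {s} → Pred Carrier s → Pred Carrier _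
    Vis A x = ∀ {a} → a ∈ A → ∀ p → x +⟨ p ⟩ a ∈ A

    MoreThanOne : ∀ {s} → Pred Carrier s → Set _
    MoreThanOne A = ∃₂ λ x y → x ∈ A × y ∈ A × ¬ x ≋ y

    open Derived Y

    closed : ∀ {s} (S : Subset carrier s) → IsConvex S →
             ∀ {n} (p : Weights n) x → (∀ i → x i ∈ pred S) → comb p x ∈ pred S
    closed S conv {zero} p x x∈S =
      resp S (≋-sym (projection p x zero (trans (sym (+-identityʳ _)) (Σ≈1 p)))) (x∈S zero)
    closed S conv {suc n} p x x∈S
      with s , eq ← normalise (w p ∘ suc) (0≤w p ∘ suc) =
      resp S (≋-sym (split p s eq′ x)) two
      where
      tail≈ : sum (w p ∘ suc) ≈ 1# - w p zero
      tail≈ = begin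
        sum (w p ∘ suc)                                ≈⟨ +-identityʳ _ ⟨
        sum (w p ∘ suc) + 0#                           ≈⟨ +-congˡ (-‿inverseʳ (w p zero)) ⟨
        sum (w p ∘ suc) + (w p zero - w p zero)        ≈⟨ +-assoc _ _ _ ⟨
        (sum (w p ∘ suc) + w p zero) - w p zero        ≈⟨ +-congʳ (trans (+-comm _ _) (Σ≈1 p)) ⟩
        1# - w p zero                                  ∎
      eq′ : ∀ i → w p (suc i) ≈ (1# - w p zero) * w s i
      eq′ i = trans (eq i) (*-congʳ tail≈)
      rest∈S : comb s (x ∘ suc) ∈ pred S
      rest∈S = closed S conv s (x ∘ suc) (x∈S ∘ suc)
      pw = pairWeights (w p zero) (0≤w p zero) (w≤1 p zero)
      two : comb pw (pair (x zero) (comb s (x ∘ suc))) ∈ pred S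
      two with 0≤w p zero | w≤1 p zero
      ... | inj₁ 0<p | inj₁ p<1 = resp S (comb-cong (λ _ → refl) (λ _ → ≋-refl))
        (conv (record { value = w p zero ; 0< = 0<p ; <1 = p<1 }) (x∈S zero) rest∈S)
      ... | inj₂ 0≈p | _ = resp S (≋-sym (projection _ _ (suc zero) (begin
        1# - w p zero            ≈⟨ +-identityˡ _ ⟨
        0# + (1# - w p zero)     ≈⟨ +-congʳ 0≈p ⟩
        w p zero + (1# - w p zero)  ≈⟨ x+[1-x]≈1 (w p zero) ⟩
        1#                       ∎))) rest∈S
      ... | inj₁ _ | inj₂ p≈1 = resp S (≋-sym (projection _ _ zero p≈1)) (x∈S zero)

    subalgebra : ∀ {s} (S : Subset carrier s) → IsConvex S → ConvexAlgebra (c ⊔ s) e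
    subalgebra S conv = record
      { carrier   = On.setoid {B = ∃ (pred S)} carrier proj₁
      ; structure = record
        { comb       = λ p x → comb p (proj₁ ∘ x) , closed S conv p (proj₁ ∘ x) (proj₂ ∘ x)
        ; comb-cong  = comb-cong
        ; projection = λ p x → projection p (proj₁ ∘ x)
        ; barycenter = λ p q x → barycenter p q (proj₁ ∘ x)
        }
      }

  -- The algebra of nonempty convex subsets; combinations are taken pointwise.
  module _ (Y : ConvexAlgebra ℓ ℓ) where
    open ConvexAlgebra Y

    record ConvexSet : Set (lsuc ℓ) where
      field
        subset   : Subset carrier ℓ
        nonempty : ∃ λ x → x ∈ pred subset
        convex   : IsConvex Y subset
      elements : Pred Carrier ℓ
      elements = pred subset

    open ConvexSet

    open Derived Y

    private
      Comb : ∀ {n} → Weights n → (Fin (suc n) → ConvexSet) → Pred Carrier ℓ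
      Comb p A v = ∃ λ a → (∀ i → a i ∈ elements (A i)) × v ≋ comb p a

      Comb-⊆ : ∀ {n} {p q : Weights n} {A B : Fin (suc n) → ConvexSet} →
               (∀ i → w p i ≈ w q i) → (∀ i → elements (A i) ⊆ elements (B i)) →
               Comb p A ⊆ Comb q B
      Comb-⊆ p≈q A⊆B (a , a∈A , v≋) =
        a , (λ i → A⊆B i (a∈A i)) , ≋-trans v≋ (comb-cong p≈q (λ _ → ≋-refl))

      combSet : ∀ {n} → Weights n → (Fin (suc n) → ConvexSet) → ConvexSet
      combSet p A = record
        { subset = record
          { pred = Comb p A
          ; resp = λ { x≋y (a , a∈A , x≋) → a , a∈A , ≋-trans (≋-sym x≋y) x≋ } }
        ; nonempty = _ , proj₁ ∘ nonempty ∘ A , proj₂ ∘ nonempty ∘ A , ≋-refl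
        ; convex = λ { t (a , a∈A , x≋) (b , b∈A , y≋) →
            (λ j → a j +⟨ t ⟩ b j) ,
            (λ j → convex (A j) t (a∈A j) (b∈A j)) ,
            ≋-trans (+⟨⟩-cong t x≋ y≋)
            (≋-trans (≋-sym (comb-binary t (λ i → comb p (pair a b i))))
            (≋-trans (interchange (binary t) (const p) p (const (binary t))
                                  (λ i j → *-comm _ _) (pair a b))
                     (comb-cong (λ _ → refl) (λ j → comb-binary t (λ i → pair a b i j))))) }
        }

      Comb-projection : ∀ {n} (p : Weights n) A j → w p j ≈ 1# → Comb p A ≐ elements (A j)
      Comb-projection {n} p A j pj≈1 = to , from
        where
        to : Comb p A ⊆ elements (A j)
        to (a , a∈A , v≋) =
          resp (subset (A j)) (≋-sym (≋-trans v≋ (projection p a j pj≈1))) (a∈A j)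
        from : elements (A j) ⊆ Comb p A
        from {v} v∈Aj = a , a∈A , ≋-sym (≋-trans (projection p a j pj≈1) (at-j (j ≟ j)))
          where
          choose : ∀ i → Dec (i ≡ j) → ∃ λ x → x ∈ elements (A i)
          choose i (yes ≡.refl) = v , v∈Aj
          choose i (no _)       = nonempty (A i)
          a : Fin (suc n) → Carrier
          a i = proj₁ (choose i (i ≟ j))
          a∈A : ∀ i → a i ∈ elements (A i)
          a∈A i = proj₂ (choose i (i ≟ j))
          at-j : (d : Dec (j ≡ j)) → proj₁ (choose j d) ≋ v
          at-j (yes ≡.refl) = ≋-refl
          at-j (no j≢j)     = contradiction ≡.refl j≢j

      Comb-barycenter : ∀ {n m} (p : Weights n) (q : Fin (suc n) → Weights m) A →
                        Comb p (λ i → combSet (q i) A) ≐ Comb (mix p q) A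
      Comb-barycenter {n} {m} p q A = to , from
        where
        cond : ∀ j → Σ (Weights n) λ s → ∀ i → w p i * w (q i) j ≈ w (mix p q) j * w s i
        cond j = normalise (λ i → w p i * w (q i) j) (λ i → 0≤* (0≤w p i) (0≤w (q i) j))
        to : Comb p (λ i → combSet (q i) A) ⊆ Comb (mix p q) A
        to (a , a∈ , v≋) =
          (λ j → comb (proj₁ (cond j)) (λ i → b i j)) ,
          (λ j → closed Y (subset (A j)) (convex (A j)) _ _ (λ i → proj₁ (proj₂ (a∈ i)) j)) ,
          ≋-trans v≋
          (≋-trans (comb-cong (λ _ → refl) (λ i → proj₂ (proj₂ (a∈ i))))
                   (interchange p q (mix p q) (proj₁ ∘ cond) (λ i j → proj₂ (cond j) i) b))
          where
          b : Fin (suc n) → Fin (suc m) → Carrier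
          b i = proj₁ (a∈ i)
        from : Comb (mix p q) A ⊆ Comb p (λ i → combSet (q i) A)
        from (a , a∈A , v≋) =
          (λ i → comb (q i) a) , (λ i → a , a∈A , ≋-refl) ,
          ≋-trans v≋ (≋-sym (barycenter p q a))

    Pc : ConvexAlgebra (lsuc ℓ) ℓ
    Pc = record
      { carrier = record
        { Carrier = ConvexSet
        ; _≈_ = λ A B → elements A ≐ elements B
        ; isEquivalence = record
          { refl  = (λ x → x) , (λ x → x)
          ; sym   = λ { (f , g) → g , f }
          ; trans = λ { (f , g) (f′ , g′) → (λ x → f′ (f x)) , (λ x → g (g′ x)) }
          }
        }
      ; structure = record
        { comb       = combSet
        ; comb-cong  = λ {_} {p} {q} {A} {B} p≈q A≐B →
            Comb-⊆ {p = p} {q} {A} {B} p≈q (proj₁ ∘ A≐B) ,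
            Comb-⊆ {p = q} {p} {B} {A} (sym ∘ p≈q) (proj₂ ∘ A≐B)
        ; projection = Comb-projection
        ; barycenter = Comb-barycenter
        }
      }

    ｛_｝ : Carrier → ConvexSet
    ｛ v ｝ = record
      { subset   = record { pred = _≋ v ; resp = λ x≋y x≋v → ≋-trans (≋-sym x≋y) x≋v }
      ; nonempty = v , ≋-refl
      ; convex   = λ p x≋v y≋v → ≋-trans (+⟨⟩-cong p x≋v y≋v)
          (≋-trans (≋-sym (comb-binary p (const v))) (idempotent (binary p) v))
      }

  open ConvexSet public

  module _ {c e} (V : Module commutativeRing c e) where
    open Module V
    open Algebra.Properties.AbelianGroup +ᴹ-abelianGroup using (inverseʳ-unique)
    private
      module M = Algebra.Properties.CommutativeMonoid.Sum +ᴹ-commutativeMonoid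
      module S = Setoid ≈ᴹ-setoid

      *ₗ-sum : ∀ {n} r (x : Fin n → Carrierᴹ) → r *ₗ M.sum x ≈ᴹ M.sum (λ i → r *ₗ x i)
      *ₗ-sum {zero}  r x = *ₗ-zeroʳ r
      *ₗ-sum {suc n} r x = S.trans (*ₗ-distribˡ r _ _) (+ᴹ-congˡ (*ₗ-sum r (x ∘ suc)))

      sum-*ₗ : ∀ {n} (t : Fin n → ℝ) v → sum t *ₗ v ≈ᴹ M.sum (λ i → t i *ₗ v)
      sum-*ₗ {zero}  t v = *ₗ-zeroˡ v
      sum-*ₗ {suc n} t v = S.trans (*ₗ-distribʳ v _ _) (+ᴹ-congˡ (sum-*ₗ (t ∘ suc) v))

      sumᴹ-zero : ∀ {n} (x : Fin n → Carrierᴹ) → (∀ i → x i ≈ᴹ 0ᴹ) → M.sum x ≈ᴹ 0ᴹ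
      sumᴹ-zero {n} x p = S.trans (M.sum-cong-≋ p) (M.sum-replicate-zero n)

      concentrated : ∀ {n} (t : Fin n → ℝ) → (∀ i → 0# ≤ t i) → sum t ≈ 1# →
                     ∀ j → t j ≈ 1# → ∀ i → t i ≈ δ j i
      concentrated t 0≤t Σ zero tj zero = tj
      concentrated t 0≤t Σ zero tj (suc i) =
        ≤-antisym (≤-respʳ rest≈0 (term≤sum (t ∘ suc) (0≤t ∘ suc) i)) (0≤t (suc i))
        where
        rest≈0 : sum (t ∘ suc) ≈ 0#
        rest≈0 = begin
          sum (t ∘ suc)                       ≈⟨ +-identityˡ _ ⟨
          0# + sum (t ∘ suc)                  ≈⟨ +-congʳ (-‿inverseˡ (t zero)) ⟨
          (- t zero + t zero) + sum (t ∘ suc) ≈⟨ +-assoc _ _ _ ⟩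
          - t zero + sum t                    ≈⟨ +-cong (-‿cong tj) Σ ⟩
          - 1# + 1#                           ≈⟨ -‿inverseˡ 1# ⟩
          0#                                  ∎
      concentrated t 0≤t Σ (suc j) tj i = go i
        where
        rest : ℝ
        rest = sum (t ∘ suc)
        1≤rest : 1# ≤ rest
        1≤rest = ≤-respˡ tj (term≤sum (t ∘ suc) (0≤t ∘ suc) j)
        rest≈1 : rest ≈ 1#
        rest≈1 = ≤-antisym (≤-respʳ Σ (y≤x+y rest (0≤t zero))) 1≤rest
        t₀≈0 : t zero ≈ 0#
        t₀≈0 = begin
          t zero                   ≈⟨ +-identityʳ _ ⟨
          t zero + 0#              ≈⟨ +-congˡ (-‿inverseʳ rest) ⟨
          t zero + (rest - rest)   ≈⟨ +-assoc _ _ _ ⟨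
          sum t - rest             ≈⟨ +-cong Σ (-‿cong rest≈1) ⟩
          1# - 1#                  ≈⟨ -‿inverseʳ 1# ⟩
          0#                       ∎
        go : ∀ i → t i ≈ δ (suc j) i
        go zero    = t₀≈0
        go (suc i) = concentrated (t ∘ suc) (0≤t ∘ suc) rest≈1 j tj i

      sumᴹ-δ : ∀ {n} j (x : Fin n → Carrierᴹ) → M.sum (λ i → δ j i *ₗ x i) ≈ᴹ x j
      sumᴹ-δ zero x = S.trans
        (+ᴹ-cong (*ₗ-identityˡ _) (sumᴹ-zero _ (λ i → *ₗ-zeroˡ (x (suc i))))) (+ᴹ-identityʳ _)
      sumᴹ-δ (suc j) x = S.trans
        (+ᴹ-cong (*ₗ-zeroˡ _) (sumᴹ-δ j (x ∘ suc))) (+ᴹ-identityˡ _)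

      combᴹ : ∀ {n} → Weights n → (Fin (suc n) → Carrierᴹ) → Carrierᴹ
      combᴹ p x = M.sum (λ i → w p i *ₗ x i)

      combᴹ-barycenter : ∀ {n m} (p : Weights n) (q : Fin (suc n) → Weights m) x →
                         combᴹ p (λ i → combᴹ (q i) x) ≈ᴹ combᴹ (mix p q) x
      combᴹ-barycenter {n} p q x =
        S.trans (M.sum-cong-≋ (λ i → S.trans (*ₗ-sum (w p i) (λ j → w (q i) j *ₗ x j))
                   (M.sum-cong-≋ (λ j → S.sym (*ₗ-assoc (w p i) (w (q i) j) (x j))))))
        (S.trans (M.∑-comm (λ i j → (w p i * w (q i) j) *ₗ x j))
                 (M.sum-cong-≋ (λ j → S.sym (sum-*ₗ (λ i → w p i * w (q i) j) (x j)))))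

      combᴹ-neg : ∀ {n} (p : Weights n) x → combᴹ p (λ i → -ᴹ x i) ≈ᴹ -ᴹ combᴹ p x
      combᴹ-neg p x = inverseʳ-unique _ _
        (S.trans (S.sym (M.∑-distrib-+ (λ i → w p i *ₗ x i) (λ i → w p i *ₗ (-ᴹ x i))))
          (sumᴹ-zero _ (λ i → S.trans (S.sym (*ₗ-distribˡ (w p i) (x i) (-ᴹ x i)))
            (S.trans (*ₗ-congˡ (-ᴹ‿inverseʳ (x i))) (*ₗ-zeroʳ (w p i))))))

      combᴹ-difference : ∀ {n} (p : Weights n) x y →
                         combᴹ p (λ i → x i +ᴹ -ᴹ y i) ≈ᴹ combᴹ p x +ᴹ -ᴹ combᴹ p y
      combᴹ-difference p x y =
        S.trans (M.sum-cong-≋ (λ i → *ₗ-distribˡ (w p i) (x i) (-ᴹ y i)))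
        (S.trans (M.∑-distrib-+ (λ i → w p i *ₗ x i) (λ i → w p i *ₗ (-ᴹ y i)))
                 (+ᴹ-congˡ (combᴹ-neg p y)))

    vectorAlgebra : ConvexAlgebra c e
    vectorAlgebra = record
      { carrier   = ≈ᴹ-setoid
      ; structure = record
        { comb       = combᴹ
        ; comb-cong  = λ p≈q x≈y → M.sum-cong-≋ (λ i → *ₗ-cong (p≈q i) (x≈y i))
        ; projection = λ p x j pj≈1 → S.trans
            (M.sum-cong-≋ (λ i → *ₗ-congʳ {x i} (concentrated (w p) (0≤w p) (Σ≈1 p) j pj≈1 i)))
            (sumᴹ-δ j x)
        ; barycenter = combᴹ-barycenter
        }
      }

    module _ {s} (A : Subset ≈ᴹ-setoid s) where

      difference : Subset ≈ᴹ-setoid (c ⊔ e ⊔ s)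
      difference = record
        { pred = λ v → ∃₂ λ x y → x ∈ pred A × y ∈ pred A × v ≈ᴹ x +ᴹ -ᴹ y
        ; resp = λ { u≈v (x , y , x∈A , y∈A , u≈) → x , y , x∈A , y∈A , S.trans (S.sym u≈v) u≈ }
        }

      difference-convex : IsConvex vectorAlgebra A → IsConvex vectorAlgebra difference
      difference-convex conv p (x , y , x∈A , y∈A , u≈) (x′ , y′ , x′∈A , y′∈A , v≈) =
        x +⟨ p ⟩ x′ , y +⟨ p ⟩ y′ , conv p x∈A x′∈A , conv p y∈A y′∈A ,
        S.trans (+⟨⟩-cong p u≈ v≈)
        (S.trans (S.sym (comb-binary p (λ i → pair x x′ i +ᴹ -ᴹ pair y y′ i)))
                 (combᴹ-difference (binary p) (pair x x′) (pair y y′)))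
        where open ConvexAlgebra vectorAlgebra using (_+⟨_⟩_; +⟨⟩-cong; comb-binary)

  private
    positives : Subset setoid ℓ
    positives = record { pred = 0# <_ ; resp = <-respʳ-≈ }

    positives-convex : IsConvex (vectorAlgebra ⟨module⟩) positives
    positives-convex p 0<x 0<y = 0<+ (*-pos (0< p) 0<x)
      (<-respʳ-≈ (sym (+-identityʳ _)) (*-pos 0<1-p 0<y))
      where
      0<1-p : 0# < 1# - value p
      0<1-p = <-respˡ-≈ (-‿inverseʳ _) (+-monoˡ-< (- value p) (<1 p))
      0<+ : ∀ {x y} → 0# < x → 0# < y → 0# < x + y
      0<+ {x} {y} q r = <-trans r (<-respˡ-≈ (+-identityˡ y) (+-monoˡ-< y q))

  -- The convex algebra (0,∞) ⊆ ℝ.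
  ℝ⁺ : ConvexAlgebra ℓ ℓ
  ℝ⁺ = subalgebra (vectorAlgebra ⟨module⟩) positives positives-convex

  LinearlyBounded : ∀ {c e} → ConvexAlgebra c e → Set _
  LinearlyBounded Y = (h : Homomorphism ℝ⁺ Y) → ∀ s t →
    ConvexAlgebra._≋_ Y (Homomorphism.map h s) (Homomorphism.map h t)

  -- The carrier X ∪ {*} is `Maybe X`, with * = `nothing`.
  record OnePointExtension {c e} (X : ConvexAlgebra c e) : Set (ℓ ⊔ lsuc (c ⊔ e)) where
    private module X = ConvexAlgebra X
    field
      structure : ConvexStructure (Maybe-setoid X.carrier)
    algebra : ConvexAlgebra c (c ⊔ e)
    algebra = record { carrier = Maybe-setoid X.carrier ; structure = structure }
    open ConvexAlgebra algebra public
    field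
      restricts : ∀ {n} (p : Weights n) (x : Fin (suc n) → X.Carrier) →
                  comb p (just ∘ x) ≋ just (X.comb p x)

  infix 4 _≈ᴱ_
  _≈ᴱ_ : ∀ {c e} {X : ConvexAlgebra c e} → Rel (OnePointExtension X) _
  E ≈ᴱ F = ∀ {n} (p : Weights n) x → E.comb p x E.≋ F.comb p x
    where
    module E = OnePointExtension E
    module F = OnePointExtension F

module Extensions {ℓ} (R : CompleteOrderedField ℓ) (V : VectorSpace R)
                  (D : Subset (Module.≈ᴹ-setoid V) ℓ)
                  (D-convex : Convexity.IsConvex R (Convexity.vectorAlgebra R V) D) where
  open Convexity R

  𝕍 𝔻 D-D : ConvexAlgebra ℓ ℓ
  𝕍   = vectorAlgebra V
  𝔻   = subalgebra 𝕍 D D-convex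
  D-D = subalgebra 𝕍 (difference V D) (difference-convex V D D-convex)

  private
    module 𝕍 = ConvexAlgebra 𝕍
    module 𝔻 = ConvexAlgebra 𝔻
    module Pc𝕍 = ConvexAlgebra (Pc 𝕍)

    inD : Subset Pc𝕍.carrier ℓ
    inD = record
      { pred = λ A → elements A ⊆ pred D ; resp = λ A≋B A⊆D x∈B → A⊆D (proj₂ A≋B x∈B) }

    inD-convex : IsConvex (Pc 𝕍) inD
    inD-convex p A⊆D B⊆D (a , a∈ , v≋) =
      resp D (𝕍.≋-sym (𝕍.≋-trans v≋ (𝕍.comb-binary p a)))
             (D-convex p (A⊆D (a∈ zero)) (B⊆D (a∈ (suc zero))))

  -- 𝒫_c 𝔻 as the subalgebra of 𝒫_c 𝕍 of the sets contained in D; the inclusion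
  -- into 𝒫_c 𝕍 is `proj₁`.
  𝕏 : ConvexAlgebra (lsuc ℓ) ℓ
  𝕏 = subalgebra (Pc 𝕍) inD inD-convex

  private module 𝕏 = ConvexAlgebra 𝕏

  -- The singleton {v} as an element of 𝒫_c 𝔻.
  ⟪_⟫ : 𝔻.Carrier → 𝕏.Carrier
  ⟪ v , v∈D ⟫ = ｛_｝ 𝕍 v , λ x≋v → resp D (𝕍.≋-sym x≋v) v∈D

  _⊆Vis : Pc𝕍.Carrier → Set ℓ
  C ⊆Vis = elements C ⊆ Vis 𝕍 (pred D)

  I : Pc𝕍.Carrier → Pred 𝕏.Carrier (lsuc ℓ)
  I C = Conv 𝕏 (λ A → ¬ Pc𝕍.Adheres (proj₁ A) C)

  record PrimeCase : Set (lsuc (lsuc ℓ)) where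
    field
      C       : Pc𝕍.Carrier
      C⊆Vis   : C ⊆Vis
      C-large : MoreThanOne 𝕍 (elements C)
      I≢X     : ¬ (∀ A → A ∈ I C)
      P       : Subset 𝕏.carrier (lsuc ℓ)
      P-prime : IsPrimeIdeal 𝕏 P
      P≢X     : ¬ (∀ A → A ∈ pred P)
      I⊆P     : I C ⊆ pred P

  open PrimeCase

  -- The four kinds of one-point extension; `≈ᴾ` is equality of case and of data.
  data Prescription : Set (lsuc (lsuc ℓ)) where
    blackHole : Prescription
    imitate   : (C : Pc𝕍.Carrier) → C ⊆Vis → Prescription
    extremal  : (v : 𝔻.Carrier) → Extremal 𝔻 v → Prescription
    prime     : PrimeCase → Prescription

  infix 4 _≈ᴾ_
  data _≈ᴾ_ : Rel Prescription (lsuc (lsuc ℓ)) where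
    blackHole : blackHole ≈ᴾ blackHole
    imitate   : ∀ {C C′} {s : C ⊆Vis} {s′ : C′ ⊆Vis} →
                C Pc𝕍.≋ C′ → imitate C s ≈ᴾ imitate C′ s′
    extremal  : ∀ {v v′} {e : Extremal 𝔻 v} {e′ : Extremal 𝔻 v′} →
                v 𝔻.≋ v′ → extremal v e ≈ᴾ extremal v′ e′
    prime     : ∀ {d d′} → C d Pc𝕍.≋ C d′ → pred (P d) ≐ pred (P d′) → prime d ≈ᴾ prime d′

  module _ (E : OnePointExtension 𝕏) where
    open OnePointExtension E

    AdheresTo* : 𝕏.Carrier → Set _
    AdheresTo* A = Adheres (just A) nothing

    -- p A + (1 - p) * is required to be an element of X, and that element to be
    -- p A + (1 - p) C as a subset of V.
    Imitates : Pc𝕍.Carrier → ∀ {s} → Pred 𝕏.Carrier s → Set _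
    Imitates C Q = ∀ {A} → A ∈ Q → ∀ p → ∃ λ B →
      (just A +⟨ p ⟩ nothing ≋ just B) × (proj₁ B Pc𝕍.≋ proj₁ A Pc𝕍.+⟨ p ⟩ C)

    Realizes : Prescription → Set (lsuc ℓ)
    Realizes blackHole      = ∀ A → AdheresTo* A
    Realizes (imitate C _)  = Imitates C U
    Realizes (extremal v _) =
      Imitates (proj₁ ⟪ v ⟫) (λ A → ¬ A 𝕏.≋ ⟪ v ⟫) × AdheresTo* ⟪ v ⟫
    Realizes (prime d)      =
      Imitates (C d) (pred (P d)) × (∀ {A} → A ∉ pred (P d) → AdheresTo* A)

{-# OPTIONS --safe #-}
module Submission where

open import Axiom.ExcludedMiddle using (ExcludedMiddle)
open import Data.Product using (∃!; _×_)
open import Algebra.Module.Bundles using (Module)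
open import Defs

open import Level using (Lift; lift; lower; _⊔_) renaming (suc to lsuc)
open import Algebra.Bundles using (CommutativeMonoid)
open import Algebra.Module.Construct.TensorUnit using (⟨module⟩)
open import Data.Empty using (⊥)
open import Data.Fin.Base using (Fin; zero; suc)
open import Data.Fin.Properties using (_≟_)
open import Data.Maybe.Base using (Maybe; just; nothing)
open import Data.Maybe.Relation.Binary.Pointwise using (just; nothing; drop-just)
  renaming (setoid to Maybe-setoid)
open import Data.Nat.Base using (zero; suc)
open import Data.Product using (∃; _,_; proj₁; proj₂)
open import Data.Product.Relation.Binary.Pointwise.NonDependent using (×-setoid)
open import Data.Sum.Base using (_⊎_; inj₁; inj₂)
open import Data.Unit.Base using (⊤; tt)
open import Function.Base using (_∘_; const)
open import Relation.Binary.Bundles using (Setoid)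
open import Relation.Binary.Definitions using (tri<; tri≈; tri>)
open import Relation.Binary.PropositionalEquality.Core as ≡ using (_≡_)
open import Relation.Binary.Structures using (IsStrictTotalOrder)
open import Relation.Nullary.Decidable.Core using (Dec; yes; no)
open import Relation.Nullary.Negation.Core using (¬_; contradiction)
open import Relation.Unary using (Pred; U; _∈_; _∉_; _⊆_)
import Algebra.Properties.AbelianGroup
import Algebra.Properties.CommutativeMonoid.Sum
import Algebra.Properties.CommutativeSemigroup
import Algebra.Properties.Ring
import Algebra.Properties.Semiring.Sum
import Relation.Binary.Reasoning.Setoid

-- From a set C and a prime ideal P such that every A ∉ P adheres to C, an extension arises by
-- letting * act as C against P and absorb the rest: sending * to C embeds X ∪ {*} into the
-- product of 𝒫_c 𝕍 and the chain (X ∖ P) < * < P, where a combination in the chain is the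
-- maximum over its support.  The black hole is the case P = ∅, C = V.
--
-- Conversely, the elements not adhering to * form a prime ideal P.  If P contains a singleton
-- {z}, then ½{z} + ½* lies in X and equals ½{z} + ½C for some C; mixing with {z} and cancelling
-- it again shows that * acts as C.  A singleton {a} ∉ P adheres to C, so C is a cone with apex a,
-- and linear boundedness leaves C = {a}.  If P is nonempty but contains no singleton, then
-- ½A + ½* with A ∈ P is invariant under translations along D - D, so D contains a ray,
-- against linear boundedness.

-- The chain coordinate is needed because C may itself be the image of a set in X, as with C = {w}
-- in the extremal case. The two coordinates together are injective, so every law of the extension
-- reduces to the same law in 𝒫_c 𝕍 and a comparison of supports.
--
-- Conversely, adherence quantifies over all p, whereas a set outside P' (the sets not adhering to
-- *) is first met through one equation pA + (1-p)* = *. One such equation must already force all of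
-- them; otherwise imitation on the non-adhering sets would make no sense (`collapse`). This fact,
-- the cone argument and the translation argument all pass from one scale to every scale by
-- doubling; only there does the completeness of ℝ enter.
--
-- A singleton in P is sought because cancellation in 𝒫_c 𝕍 can fail for larger sets. Linear
-- boundedness is used in one form: D contains no ray (`no-ray`).

-- Ordered field arithmetic and induction by doubling.

module OrderedField {ℓ} (R : CompleteOrderedField ℓ) where
  open CompleteOrderedField R hiding (zero)
  open IsStrictTotalOrder isStrictTotalOrder using (compare; irrefl; asym; <-respˡ-≈; <-respʳ-≈)
    renaming (trans to <-trans)
  open Convexity R
  open Algebra.Properties.Ring ring
  open Relation.Binary.Reasoning.Setoid setoid

  1-[1-x]≈x : ∀ x → 1# - (1# - x) ≈ x
  1-[1-x]≈x x = begin
    1# - (1# - x)          ≈⟨ +-congʳ (x+[1-x]≈1 x) ⟨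
    x + (1# - x) - (1# - x) ≈⟨ +-assoc _ _ _ ⟩
    x + ((1# - x) - (1# - x)) ≈⟨ +-congˡ (-‿inverseʳ _) ⟩
    x + 0#                 ≈⟨ +-identityʳ x ⟩
    x                      ∎

  ≮⇒≥ : ∀ {x y} → ¬ x < y → y ≤ x
  ≮⇒≥ {x} {y} x≮y with compare x y
  ... | tri< x<y _ _ = contradiction x<y x≮y
  ... | tri≈ _ x≈y _ = inj₂ (sym x≈y)
  ... | tri> _ _ y<x = inj₁ y<x

  <-≤-trans : ∀ {x y z} → x < y → y ≤ z → x < z
  <-≤-trans x<y (inj₁ y<z) = <-trans x<y y<z
  <-≤-trans x<y (inj₂ y≈z) = <-respʳ-≈ y≈z x<y

  ≤-<-trans : ∀ {x y z} → x ≤ y → y < z → x < z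
  ≤-<-trans (inj₁ x<y) y<z = <-trans x<y y<z
  ≤-<-trans (inj₂ x≈y) y<z = <-respˡ-≈ (sym x≈y) y<z

  x<y+x : ∀ {y} x → 0# < y → x < y + x
  x<y+x x 0<y = <-respˡ-≈ (+-identityˡ x) (+-monoˡ-< x 0<y)

  0<+ : ∀ {x y} → 0# < x → 0# < y → 0# < x + y
  0<+ 0<x 0<y = <-trans 0<y (x<y+x _ 0<x)

  0<y-x : ∀ {x y} → x < y → 0# < y - x
  0<y-x {x} x<y = <-respˡ-≈ (-‿inverseʳ x) (+-monoˡ-< (- x) x<y)

  1-x<1 : ∀ {x} → 0# < x → 1# - x < 1#
  1-x<1 {x} 0<x = <-respʳ-≈ (x+[1-x]≈1 x) (x<y+x (1# - x) 0<x)

  y-x+x≈y : ∀ x y → y - x + x ≈ y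
  y-x+x≈y x y = trans (+-assoc y (- x) x) (trans (+-congˡ (-‿inverseˡ x)) (+-identityʳ y))

  *-monoˡ-< : ∀ {x y z} → 0# < z → x < y → z * x < z * y
  *-monoˡ-< {x} {y} {z} 0<z x<y =
    <-respʳ-≈ (trans (sym (distribˡ z (y - x) x)) (*-congˡ (y-x+x≈y x y)))
      (x<y+x (z * x) (*-pos 0<z (0<y-x x<y)))

  *-monoˡ-≤ : ∀ {x y z} → 0# < z → x ≤ y → z * x ≤ z * y
  *-monoˡ-≤ 0<z (inj₁ x<y) = inj₁ (*-monoˡ-< 0<z x<y)
  *-monoˡ-≤ 0<z (inj₂ x≈y) = inj₂ (*-congˡ x≈y)

  reciprocal : ∀ {x} → 0# < x → ∃ λ y → 0# < y × x * y ≈ 1#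
  reciprocal {x} 0<x with y , xy≈1 ← inverse x (λ x≈0 → irrefl (sym x≈0) 0<x) =
    y , positive-inverse 0<x xy≈1 , xy≈1

  ∁ : Unit° → Unit°
  ∁ p = record { value = 1# - value p ; 0< = 0<y-x (<1 p) ; <1 = 1-x<1 (0< p) }

  infixl 7 _·_
  _·_ : Unit° → Unit° → Unit°
  p · q = record
    { value = value p * value q
    ; 0<    = *-pos (0< p) (0< q)
    ; <1    = <-trans (<-respʳ-≈ (*-identityʳ _) (*-monoˡ-< (0< p) (<1 q))) (<1 p)
    }

  ratio : ∀ {x y} → 0# < x → x < y → ∃ λ p → value p * y ≈ x
  ratio {x} {y} 0<x x<y with y⁻¹ , 0<y⁻¹ , yy⁻¹≈1 ← reciprocal (<-trans 0<x x<y) =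
    record
      { value = y⁻¹ * x
      ; 0<    = *-pos 0<y⁻¹ 0<x
      ; <1    = <-respʳ-≈ (trans (*-comm y⁻¹ y) yy⁻¹≈1) (*-monoˡ-< 0<y⁻¹ x<y)
      } ,
    (begin
      y⁻¹ * x * y   ≈⟨ *-congʳ (*-comm y⁻¹ x) ⟩
      x * y⁻¹ * y   ≈⟨ *-assoc x y⁻¹ y ⟩
      x * (y⁻¹ * y) ≈⟨ *-congˡ (trans (*-comm y⁻¹ y) yy⁻¹≈1) ⟩
      x * 1#        ≈⟨ *-identityʳ x ⟩
      x             ∎)

  0<1+1 : 0# < 1# + 1#
  0<1+1 = 0<+ 0<1 0<1

  private
    1<1+1 : 1# < 1# + 1#
    1<1+1 = x<y+x 1# 0<1

  abstract
    ½ : Unit°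
    ½ = proj₁ (ratio 0<1 1<1+1)

    ½+½≈1 : value ½ + value ½ ≈ 1#
    ½+½≈1 = begin
      value ½ + value ½           ≈⟨ +-cong (*-identityʳ _) (*-identityʳ _) ⟨
      value ½ * 1# + value ½ * 1# ≈⟨ distribˡ (value ½) 1# 1# ⟨
      value ½ * (1# + 1#)         ≈⟨ proj₂ (ratio 0<1 1<1+1) ⟩
      1#                          ∎

  1-½≈½ : 1# - value ½ ≈ value ½
  1-½≈½ = begin
    1# - value ½                    ≈⟨ +-congʳ ½+½≈1 ⟨
    value ½ + value ½ - value ½     ≈⟨ +-assoc _ _ _ ⟩
    value ½ + (value ½ - value ½)   ≈⟨ +-congˡ (-‿inverseʳ _) ⟩
    value ½ + 0#                    ≈⟨ +-identityʳ _ ⟩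
    value ½                         ∎

  module _ (em : ∀ a → ExcludedMiddle a) where

    private
      -- Suprema exist for predicates at level ℓ only; recording just the outcome of a decision
      -- brings a predicate of any level down to ℓ.
      Squash : ∀ {a} {A : Set a} → Dec A → Set ℓ
      Squash (yes _) = Lift ℓ ⊤
      Squash (no _)  = Lift ℓ ⊥

      squash : ∀ {a} {A : Set a} (d : Dec A) → A → Squash d
      squash (yes _) _ = lift tt
      squash (no ¬a) a = contradiction a ¬a

      unsquash : ∀ {a} {A : Set a} (d : Dec A) → Squash d → A
      unsquash (yes a) _ = a

    -- If Q failed at x, the positive reals satisfying Q would be bounded by x and have a supremum s
    -- > 0. Doubling puts each of them below s/2, so s ≤ s/2.
    archimedean-induction : ∀ {s} (Q : Pred ℝ s) →
      (∀ {x y} → 0# < x → x < y → Q y → Q x) → (∀ {x} → 0# < x → Q x → Q (x + x)) →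
      ∀ {e} → 0# < e → Q e → ∀ {x} → 0# < x → Q x
    archimedean-induction Q down double {e} 0<e Qe {x} 0<x with em _ {Q x}
    ... | yes Qx = Qx
    ... | no ¬Qx = contradiction (≤-<-trans s≤½s ½s<s) (irrefl refl)
      where
      S : Pred ℝ ℓ
      S y = Squash (em _ {0# < y × Q y})
      ∈S : ∀ {y} → 0# < y → Q y → y ∈ S
      ∈S 0<y Qy = squash (em _) (0<y , Qy)
      S-bounded : ∀ {y} → y ∈ S → y ≤ x
      S-bounded y∈S = ≮⇒≥ (λ x<y → ¬Qx (down 0<x x<y (proj₂ (unsquash (em _) y∈S))))
      sup = supremum S (e , ∈S 0<e Qe) (x , S-bounded)
      s = proj₁ sup
      0<s : 0# < s
      0<s = <-≤-trans 0<e (proj₁ (proj₂ sup) (∈S 0<e Qe))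
      ½y+½y≈y : ∀ y → value ½ * (y + y) ≈ y
      ½y+½y≈y y = begin
        value ½ * (y + y)           ≈⟨ distribˡ _ y y ⟩
        value ½ * y + value ½ * y   ≈⟨ distribʳ y _ _ ⟨
        (value ½ + value ½) * y     ≈⟨ *-congʳ ½+½≈1 ⟩
        1# * y                      ≈⟨ *-identityˡ y ⟩
        y                           ∎
      s≤½s : s ≤ value ½ * s
      s≤½s = proj₂ (proj₂ sup) _ λ {y} y∈S → let 0<y , Qy = unsquash (em _) y∈S in
        ≤-respˡ (½y+½y≈y y)
          (*-monoˡ-≤ (0< ½) (proj₁ (proj₂ sup) (∈S (0<+ 0<y 0<y) (double 0<y Qy))))
      ½s<s : value ½ * s < s
      ½s<s = <-respˡ-≈ (*-comm s _) (<-respʳ-≈ (*-identityʳ s) (*-monoˡ-< 0<s (<1 ½)))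

-- Supports of weights.

module WeightProperties {ℓ} (R : CompleteOrderedField ℓ) where
  open CompleteOrderedField R hiding (zero)
  open IsStrictTotalOrder isStrictTotalOrder using (irrefl; <-respˡ-≈; <-respʳ-≈)
  open Convexity R
  open OrderedField R
  open Algebra.Properties.Semiring.Sum semiring
  open Algebra.Properties.Ring ring
  open Relation.Binary.Reasoning.Setoid setoid

  Positive : ∀ {n} → Weights n → Fin (suc n) → Set ℓ
  Positive p i = 0# < w p i

  positive-or-zero : ∀ {n} (p : Weights n) i → Positive p i ⊎ w p i ≈ 0#
  positive-or-zero p i with 0≤w p i
  ... | inj₁ 0<pi = inj₁ 0<pi
  ... | inj₂ 0≈pi = inj₂ (sym 0≈pi)

  sum-positive : ∀ {n} (t : Fin n → ℝ) → (∀ i → 0# ≤ t i) → 0# < sum t → ∃ λ i → 0# < t i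
  sum-positive {zero}  t 0≤t 0<0 = contradiction 0<0 (irrefl refl)
  sum-positive {suc n} t 0≤t 0<s with 0≤t zero
  ... | inj₁ 0<t₀ = zero , 0<t₀
  ... | inj₂ 0≈t₀ with i , 0<ti ← sum-positive (t ∘ suc) (0≤t ∘ suc)
                         (<-respʳ-≈ (trans (+-congʳ (sym 0≈t₀)) (+-identityˡ _)) 0<s) =
    suc i , 0<ti

  some-positive : ∀ {n} (p : Weights n) → ∃ (Positive p)
  some-positive p = sum-positive (w p) (0≤w p) (<-respʳ-≈ (sym (Σ≈1 p)) 0<1)

  Positive-factors : ∀ {x y} → 0# ≤ x → 0# ≤ y → 0# < x * y → 0# < x × 0# < y
  Positive-factors (inj₁ 0<x) (inj₁ 0<y) _  = 0<x , 0<y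
  Positive-factors (inj₂ 0≈x) _ 0<xy =
    contradiction 0<xy (irrefl (sym (trans (*-congʳ (sym 0≈x)) (zeroˡ _))))
  Positive-factors _ (inj₂ 0≈y) 0<xy =
    contradiction 0<xy (irrefl (sym (trans (*-congˡ (sym 0≈y)) (zeroʳ _))))

  mix-positive⁺ : ∀ {n m} (p : Weights n) (q : Fin (suc n) → Weights m) {i j} →
                  Positive p i → Positive (q i) j → Positive (mix p q) j
  mix-positive⁺ p q {i} {j} 0<pi 0<qij =
    <-≤-trans (*-pos 0<pi 0<qij)
      (term≤sum (λ i → w p i * w (q i) j) (λ i → 0≤* (0≤w p i) (0≤w (q i) j)) i)

  mix-positive⁻ : ∀ {n m} (p : Weights n) (q : Fin (suc n) → Weights m) {j} →
                  Positive (mix p q) j → ∃ λ i → Positive p i × Positive (q i) j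
  mix-positive⁻ p q {j} 0<mix
    with i , 0<pq ← sum-positive (λ i → w p i * w (q i) j)
                      (λ i → 0≤* (0≤w p i) (0≤w (q i) j)) 0<mix =
    i , Positive-factors (0≤w p i) (0≤w (q i) j) 0<pq

  δ≈0 : ∀ {n} {i j : Fin n} → ¬ i ≡ j → δ i j ≈ 0#
  δ≈0 {i = zero}  {zero}  i≢j = contradiction ≡.refl i≢j
  δ≈0 {i = zero}  {suc j} i≢j = refl
  δ≈0 {i = suc i} {zero}  i≢j = refl
  δ≈0 {i = suc i} {suc j} i≢j = δ≈0 (i≢j ∘ ≡.cong suc)

  second-weight : (p : Weights 1) → w p (suc zero) ≈ 1# - w p zero
  second-weight p = begin
    w p (suc zero)                                 ≈⟨ +-identityˡ _ ⟨
    0# + w p (suc zero)                            ≈⟨ +-congʳ (-‿inverseˡ (w p zero)) ⟨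
    - w p zero + w p zero + w p (suc zero)         ≈⟨ +-assoc _ _ _ ⟩
    - w p zero + (w p zero + w p (suc zero))       ≈⟨ +-congˡ (trans (+-congˡ (sym (+-identityʳ _))) (Σ≈1 p)) ⟩
    - w p zero + 1#                                ≈⟨ +-comm _ _ ⟩
    1# - w p zero                                  ∎

  weights-ext : (p q : Weights 1) → w p zero ≈ w q zero → ∀ i → w p i ≈ w q i
  weights-ext p q p₀≈q₀ zero       = p₀≈q₀
  weights-ext p q p₀≈q₀ (suc zero) =
    trans (second-weight p) (trans (+-congˡ (-‿cong p₀≈q₀)) (sym (second-weight q)))

  abstract
    -- With t = pᵢ / 2 the remaining weights s have the same support as p, so neither
    -- of the two coefficients degenerates.
    peel : ∀ {n} (p : Weights n) {i} → Positive p i →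
           ∃ λ t → ∃ λ s → Positive s i × (∀ j → w p j ≈ value t * δ i j + (1# - value t) * w s j)
    peel {n} p {i} 0<pi = t , s , 0<si , split≈
      where
      tv : ℝ
      tv = value ½ * w p i
      tv<pi : tv < w p i
      tv<pi = <-respˡ-≈ (*-comm _ _) (<-respʳ-≈ (*-identityʳ _) (*-monoˡ-< 0<pi (<1 ½)))
      t : Unit°
      t = record { value = tv ; 0< = *-pos (0< ½) 0<pi ; <1 = <-≤-trans tv<pi (w≤1 p i) }
      r : Fin (suc n) → ℝ
      r j = w p j - tv * δ i j
      at-i : r i ≈ w p i - tv
      at-i = +-congˡ (-‿cong (trans (*-congˡ (δᵢᵢ≈1 i)) (*-identityʳ tv)))
      nonneg : ∀ j → 0# ≤ r j
      nonneg j with i ≟ j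
      ... | yes ≡.refl = inj₁ (<-respʳ-≈ (sym at-i) (0<y-x tv<pi))
      ... | no i≢j = ≤-respʳ (begin
        w p j                   ≈⟨ +-identityʳ _ ⟨
        w p j + 0#              ≈⟨ +-congˡ -0#≈0# ⟨
        w p j - 0#              ≈⟨ +-congˡ (-‿cong (trans (*-congˡ (δ≈0 i≢j)) (zeroʳ tv))) ⟨
        w p j - tv * δ i j      ∎) (0≤w p j)
      p≈ : ∀ j → w p j ≈ tv * δ i j + r j
      p≈ j = trans (sym (y-x+x≈y (tv * δ i j) (w p j))) (+-comm _ _)
      total : 1# ≈ tv + sum r
      total = begin
        1#                                            ≈⟨ Σ≈1 p ⟨
        sum (w p)                                     ≈⟨ sum-cong-≋ p≈ ⟩
        sum (λ j → tv * δ i j + r j)                  ≈⟨ ∑-distrib-+ (λ j → tv * δ i j) r ⟩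
        sum (λ j → tv * δ i j) + sum r                ≈⟨ +-congʳ (*-distribˡ-sum tv (δ i)) ⟨
        tv * sum (δ i) + sum r                        ≈⟨ +-congʳ (trans (*-congˡ (Σδ≈1 i)) (*-identityʳ tv)) ⟩
        tv + sum r                                    ∎
      rest≈ : sum r ≈ 1# - tv
      rest≈ = begin
        sum r               ≈⟨ +-identityˡ _ ⟨
        0# + sum r          ≈⟨ +-congʳ (-‿inverseˡ tv) ⟨
        - tv + tv + sum r   ≈⟨ +-assoc _ _ _ ⟩
        - tv + (tv + sum r) ≈⟨ +-congˡ total ⟨
        - tv + 1#           ≈⟨ +-comm _ _ ⟩
        1# - tv             ∎
      s : Weights n
      s = proj₁ (normalise r nonneg)
      r≈ : ∀ j → r j ≈ sum r * w s j
      r≈ = proj₂ (normalise r nonneg)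
      0<si : Positive s i
      0<si = proj₂ (Positive-factors (0≤sum r nonneg) (0≤w s i)
        (<-respʳ-≈ (trans (sym at-i) (r≈ i)) (0<y-x tv<pi)))
      split≈ : ∀ j → w p j ≈ tv * δ i j + (1# - tv) * w s j
      split≈ j = trans (p≈ j) (+-congˡ (trans (r≈ j) (*-congʳ rest≈)))

  concentrated : ∀ {n} (p : Weights n) {i j} → w p j ≈ 1# → Positive p i → i ≡ j
  concentrated p {i} {j} pj≈1 0<pi with i ≟ j
  ... | yes i≡j = i≡j
  ... | no i≢j  = contradiction 0<pi (irrefl (sym (begin
    w p i                         ≈⟨ sum-δ (w p) i ⟨
    -- The projection axiom of ℝ as a convex algebra, applied to the i-th coordinates of the unit
    -- vectors.
    sum (λ k → w p k * δ k i)     ≈⟨ ℝ.projection p (λ k → δ k i) j pj≈1 ⟩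
    δ j i                         ≈⟨ δ≈0 (i≢j ∘ ≡.sym) ⟩
    0#                            ∎)))
    where
    module ℝ = ConvexAlgebra (vectorAlgebra ⟨module⟩)

-- Calculus in an arbitrary convex algebra.

module AlgebraProperties {ℓ} (R : CompleteOrderedField ℓ) {c e}
                         (Y : Convexity.ConvexAlgebra R c e) where
  open CompleteOrderedField R hiding (zero)
  open IsStrictTotalOrder isStrictTotalOrder using (irrefl; <-respʳ-≈)
  open Convexity R
  open OrderedField R
  open WeightProperties R
  open ConvexAlgebra Y
  open Derived Y
  open Algebra.Properties.Semiring.Sum semiring

  +⟨⟩-idem : ∀ {p} x → x +⟨ p ⟩ x ≋ x
  +⟨⟩-idem {p} x = ≋-trans (≋-sym (comb-binary p (const x))) (idempotent (binary p) x)

  +⟨⟩-weight : ∀ {p q x y} → value p ≈ value q → x +⟨ p ⟩ y ≋ x +⟨ q ⟩ y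
  +⟨⟩-weight {p} {q} p≈q = comb-cong (weights-ext (binary p) (binary q) p≈q) (λ _ → ≋-refl)

  +⟨⟩-comm : ∀ {x y} p → x +⟨ p ⟩ y ≋ y +⟨ ∁ p ⟩ x
  +⟨⟩-comm {x} {y} p =
    ≋-trans (comb-cong (λ _ → refl) λ { zero → ≋-refl ; (suc zero) → ≋-refl })
    (≋-trans (reindex (binary p) swap (pair y x))
             (comb-cong (weights-ext (mix (binary p) (dirac ∘ swap)) (binary (∁ p)) first) (λ _ → ≋-refl)))
    where
    swap : Fin 2 → Fin 2
    swap = pair (suc zero) zero
    first : w (mix (binary p) (dirac ∘ swap)) zero ≈ 1# - value p
    first = trans (+-cong (zeroʳ _) (trans (+-identityʳ _) (*-identityʳ _))) (+-identityˡ _)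

  entropic : ∀ p q {a b c d} → (a +⟨ q ⟩ b) +⟨ p ⟩ (c +⟨ q ⟩ d) ≋ (a +⟨ p ⟩ c) +⟨ q ⟩ (b +⟨ p ⟩ d)
  entropic p q {a} {b} {c} {d} =
    ≋-trans (comb-cong (λ _ → refl) λ { zero → ≋-refl ; (suc zero) → ≋-refl })
    (≋-trans (interchange (binary p) (const (binary q)) (binary q) (const (binary p))
                          (λ i j → *-comm _ _) m)
             (comb-cong (λ _ → refl) λ
               { zero → comb-cong (λ _ → refl) λ { zero → ≋-refl ; (suc zero) → ≋-refl }
               ; (suc zero) → comb-cong (λ _ → refl) λ { zero → ≋-refl ; (suc zero) → ≋-refl } }))
    where
    m : Fin 2 → Fin 2 → Carrier
    m = pair (pair a b) (pair c d)

  distribˡ-+⟨⟩ : ∀ p q {a b c} → a +⟨ p ⟩ (b +⟨ q ⟩ c) ≋ (a +⟨ p ⟩ b) +⟨ q ⟩ (a +⟨ p ⟩ c)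
  distribˡ-+⟨⟩ p q = ≋-trans (+⟨⟩-cong p (≋-sym (+⟨⟩-idem {q} _)) ≋-refl) (entropic p q)

  nested : ∀ p q {a b} → (a +⟨ p ⟩ b) +⟨ q ⟩ b ≋ a +⟨ q · p ⟩ b
  nested p q {a} {b} =
    ≋-trans (comb-cong {y = λ k → comb (r k) (pair a b)} (λ _ → refl)
               λ { zero → ≋-refl ; (suc zero) → at-dirac (pair a b) (suc zero) })
    (≋-trans (barycenter (binary q) r (pair a b))
             (comb-cong (weights-ext (mix (binary q) r) (binary (q · p)) first) (λ _ → ≋-refl)))
    where
    r : Fin 2 → Weights 1
    r = pair (binary p) (dirac (suc zero))
    first : w (mix (binary q) r) zero ≈ value q * value p
    first = trans (+-congˡ (trans (+-identityʳ _) (zeroʳ _))) (+-identityʳ _)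

  distribʳ-+⟨⟩ : ∀ p q {a b c} → (a +⟨ q ⟩ b) +⟨ p ⟩ c ≋ (a +⟨ p ⟩ c) +⟨ q ⟩ (b +⟨ p ⟩ c)
  distribʳ-+⟨⟩ p q = ≋-trans (+⟨⟩-cong p ≋-refl (≋-sym (+⟨⟩-idem {q} _))) (entropic p q)

  abstract
    -- In an abstract convex algebra a term of weight zero cannot simply be dropped. Instead `f`
    -- redirects its index to an index `k` of the support, which leaves all coefficients unchanged.
    comb-support : ∀ {n} (p : Weights n) {x y : Fin (suc n) → Carrier} →
                   (∀ i → Positive p i → x i ≋ y i) → comb p x ≋ comb p y
    comb-support {n} p {x} {y} x≋y =
      ≋-trans (≋-sym (restrict x)) (≋-trans (comb-cong (λ _ → refl) agree) (restrict y))
      where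
      k : Fin (suc n)
      k = proj₁ (some-positive p)
      f : Fin (suc n) → Fin (suc n)
      f i with positive-or-zero p i
      ... | inj₁ _ = i
      ... | inj₂ _ = k
      f-cases : ∀ i → f i ≡ i ⊎ w p i ≈ 0#
      f-cases i with positive-or-zero p i
      ... | inj₁ _    = inj₁ ≡.refl
      ... | inj₂ pi≈0 = inj₂ pi≈0
      f-positive : ∀ i → Positive p (f i)
      f-positive i with positive-or-zero p i
      ... | inj₁ 0<pi = 0<pi
      ... | inj₂ _    = proj₂ (some-positive p)
      agree : ∀ i → x (f i) ≋ y (f i)
      agree i = x≋y (f i) (f-positive i)
      term : ∀ j i → w p i * δ (f i) j ≈ w p i * δ i j
      term j i with f-cases i
      ... | inj₁ fi≡i = reflexive (≡.cong (λ h → w p i * δ h j) fi≡i)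
      ... | inj₂ pi≈0 = trans (trans (*-congʳ pi≈0) (zeroˡ _)) (sym (trans (*-congʳ pi≈0) (zeroˡ _)))
      restrict : ∀ z → comb p (z ∘ f) ≋ comb p z
      restrict z = ≋-trans (reindex p f z)
        (comb-cong (λ j → trans (sum-cong-≋ (term j)) (sum-δ (w p) j)) (λ _ → ≋-refl))

    closed-support : ∀ {s} (S : Subset carrier s) → IsConvex Y S → ∀ {n} (p : Weights n) x →
                     (∀ i → Positive p i → x i ∈ pred S) → comb p x ∈ pred S
    closed-support S conv {n} p x x∈S =
      resp S (comb-support p (λ i → proj₂ (proj₂ (choose i))))
        (closed Y S conv p (proj₁ ∘ choose) (λ i → proj₁ (proj₂ (choose i))))
      where
      choose : ∀ i → ∃ λ z → z ∈ pred S × (Positive p i → z ≋ x i)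
      choose i with positive-or-zero p i
      ... | inj₁ 0<pi = x i , x∈S i 0<pi , λ _ → ≋-refl
      ... | inj₂ pi≈0 with k , 0<pk ← some-positive p =
        x k , x∈S k 0<pk , λ 0<pi → contradiction 0<pi (irrefl (sym pi≈0))

    -- Lets binary facts, such as absorption or the ideal property, act on one chosen entry of a
    -- long combination. Since i stays in the support of s, the remainder is of the same kind as the
    -- whole.
    peel-comb : ∀ {n} (p : Weights n) {i} → Positive p i → ∃ λ t → ∃ λ s → Positive s i ×
                (∀ {j} → Positive s j → Positive p j) ×
                (∀ x → comb p x ≋ x i +⟨ t ⟩ comb s x)
    peel-comb {n} p {i} 0<pi with t , s , 0<si , p≈ ← peel p 0<pi =
      t , s , 0<si ,
      (λ {j} 0<sj → <-respʳ-≈ (sym (p≈ j)) (<-≤-trans (*-pos (0< (∁ t)) 0<sj)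
                      (y≤x+y _ (0≤* (inj₁ (0< t)) (0≤δ i j))))) ,
      λ x → ≋-sym
        (≋-trans (comb-cong {y = λ k → comb (q s k) x} (λ _ → refl)
                   λ { zero → at-dirac x i ; (suc zero) → ≋-refl })
        (≋-trans (barycenter (binary t) (q s) x)
                 (comb-cong (λ j → trans (+-congˡ (+-identityʳ _)) (sym (p≈ j))) (λ _ → ≋-refl))))
      where
      q : Weights n → Fin 2 → Weights n
      q s = pair (dirac i) s

  Adheres-to : Carrier → Subset carrier (ℓ ⊔ e)
  Adheres-to z = record
    { pred = λ x → Adheres x z
    ; resp = λ x≋y adh p → ≋-trans (+⟨⟩-cong p (≋-sym x≋y) ≋-refl) (adh p)
    }

  Adheres-to-convex : ∀ z → IsConvex Y (Adheres-to z)
  Adheres-to-convex z q x-adh y-adh p =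
    ≋-trans (distribʳ-+⟨⟩ p q) (≋-trans (+⟨⟩-cong q (x-adh p) (y-adh p)) (+⟨⟩-idem z))

  Conv-least : ∀ {s t} {Q : Pred Carrier t} (S : Subset carrier s) → IsConvex Y S →
               (∀ {x} → x ∈ Q → x ∈ pred S) → ∀ {x} → x ∈ Conv Y Q → x ∈ pred S
  Conv-least S conv Q⊆S (incl x∈Q)        = Q⊆S x∈Q
  Conv-least S conv Q⊆S (incl≋ x≋y x∈)    = resp S x≋y (Conv-least S conv Q⊆S x∈)
  Conv-least S conv Q⊆S (mixed p x∈ y∈)   = conv p (Conv-least S conv Q⊆S x∈) (Conv-least S conv Q⊆S y∈)

-- Building an extension from a prime ideal and an element to imitate.

module Construction {ℓ} (em : ∀ a → ExcludedMiddle a) (R : CompleteOrderedField ℓ)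
    {c e c′ e′ t} (X : Convexity.ConvexAlgebra R c e) (M : Convexity.ConvexAlgebra R c′ e′)
    (embedding : Convexity.Homomorphism R X M)
    (injective : ∀ {A B} → Convexity.ConvexAlgebra._≋_ M
                   (Convexity.Homomorphism.map embedding A) (Convexity.Homomorphism.map embedding B) →
                 Convexity.ConvexAlgebra._≋_ X A B)
    (T : Subset (Convexity.ConvexAlgebra.carrier M) t) (T-convex : Convexity.IsConvex R M T)
    (X⊆T : ∀ A → Convexity.Homomorphism.map embedding A ∈ pred T)
    (X-absorbs-T : ∀ A {m} p → m ∈ pred T → ∃ λ B → Convexity.ConvexAlgebra._≋_ M
                     (Convexity.Homomorphism.map embedding B)
                     (Convexity.ConvexAlgebra._+⟨_⟩_ M (Convexity.Homomorphism.map embedding A) p m))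
    where
  open CompleteOrderedField R using (_≈_; 1#; sym; refl; isStrictTotalOrder; 0<1)
  open IsStrictTotalOrder isStrictTotalOrder using (<-respʳ-≈)
  open Convexity R
  open OrderedField R
  open WeightProperties R

  open Homomorphism embedding renaming (map to ι; map-cong to ι-cong; map-comb to ι-comb)

  private
    module M where
      open ConvexAlgebra M public
      open AlgebraProperties R M public
    module X where
      open ConvexAlgebra X public
      open AlgebraProperties R X public

    image : Subset M.carrier (c ⊔ e′)
    image = record
      { pred = λ m → ∃ λ A → ι A M.≋ m
      ; resp = λ { m≋n (A , ιA≋m) → A , M.≋-trans ιA≋m m≋n }
      }

    image-convex : IsConvex M image
    image-convex p (A , ιA≋m) (B , ιB≋n) = A X.+⟨ p ⟩ B ,
      M.≋-trans (ι-comb (binary p) (pair A B))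
        (M.≋-trans (M.comb-binary p (ι ∘ pair A B)) (M.+⟨⟩-cong p ιA≋m ιB≋n))

  -- Membership of C in T is asked only when P is inhabited: for the black hole, C is all of V,
  -- which in general is not contained in Vis(D).
  module Extend {u} (P : Subset X.carrier u) (P-prime : IsPrimeIdeal X P) (C : M.Carrier)
           (C∈T : (∃ λ A → A ∈ pred P) → C ∈ pred T)
           (adheres : ∀ {A} → A ∉ pred P → M.Adheres (ι A) C) where

    private
      P-ideal = proj₁ P-prime
      P-complement = proj₂ P-prime

      X* : Set c
      X* = Maybe X.Carrier

      module X* = Setoid (Maybe-setoid X.carrier)

      φ : X* → M.Carrier
      φ (just A) = ι A
      φ nothing  = C

      φ-cong : ∀ {x y} → x X*.≈ y → φ x M.≋ φ y
      φ-cong (just A≋B) = ι-cong A≋B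
      φ-cong nothing    = M.≋-refl

      IsStar IsGood : X* → Set u
      IsStar (just _) = Lift _ ⊥
      IsStar nothing  = Lift _ ⊤
      IsGood (just A) = A ∈ pred P
      IsGood nothing  = Lift _ ⊥

      IsStar-resp : ∀ {x y} → x X*.≈ y → IsStar x → IsStar y
      IsStar-resp nothing star = star

      IsGood-resp : ∀ {x y} → x X*.≈ y → IsGood x → IsGood y
      IsGood-resp (just {A} {B} A≋B) = resp P {A} {B} A≋B

      -- The map φ alone may identify * with an element of X whose image is C; the bit `IsStar`
      -- separates them.
      φ-star-injective : ∀ x y → φ x M.≋ φ y → (IsStar x → IsStar y) → (IsStar y → IsStar x) → x X*.≈ y
      φ-star-injective (just A) (just B) A≋B _ _ = just (injective A≋B)
      φ-star-injective (just A) nothing  _ _ g = contradiction (g (lift tt)) lower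
      φ-star-injective nothing  (just B) _ f _ = contradiction (f (lift tt)) lower
      φ-star-injective nothing  nothing  _ _ _ = nothing

      module _ {n} (p : Weights n) (x : Fin (suc n) → X*) where
        -- `Undefined` says that the maximum over the support, taken in the chain, is *: the support
        -- meets * and misses P.
        Good Star Undefined : Set (ℓ ⊔ u)
        Good = ∃ λ i → Positive p i × IsGood (x i)
        Star = ∃ λ i → Positive p i × IsStar (x i)
        Undefined = Star × ¬ Good

        value* : M.Carrier
        value* = M.comb p (φ ∘ x)

        not-good⇒real : ¬ Undefined → ¬ Good → ∀ i → Positive p i → ∃ λ A → x i ≡ just A × A ∉ pred P
        not-good⇒real defined ¬good i 0<pi = go (x i) ≡.refl
          where
          go : ∀ y → x i ≡ y → ∃ λ A → y ≡ just A × A ∉ pred P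
          go (just A) eq = A , ≡.refl , λ A∈P → ¬good (i , 0<pi , ≡.subst IsGood (≡.sym eq) A∈P)
          go nothing  eq = contradiction ((i , 0<pi , ≡.subst IsStar (≡.sym eq) (lift tt)) , ¬good) defined

        -- An element of P in the support is peeled off and absorbs the remainder, which lies in T.
        -- Without such an element, * cannot occur in the support either, and the image of X is
        -- convex.
        value*∈X : ¬ Undefined → value* ∈ pred image
        value*∈X defined = by-cases (em _)
          where
          by-cases : Dec Good → value* ∈ pred image
          by-cases (no ¬good) = M.closed-support image image-convex p (φ ∘ x) λ i 0<pi →
            let A , xi≡ , _ = not-good⇒real defined ¬good i 0<pi
            in ≡.subst (λ y → φ y ∈ pred image) (≡.sym xi≡) (A , M.≋-refl)
          by-cases (yes (i , 0<pi , good)) with t , s , _ , _ , p≋ ← M.peel-comb p 0<pi =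
            resp image (M.≋-sym (p≋ (φ ∘ x)))
              (absorb (x i) good (closed M T T-convex s (φ ∘ x) (λ j → φ∈T (x j))))
            where
            absorb : ∀ y → IsGood y → ∀ {m} → m ∈ pred T → φ y M.+⟨ t ⟩ m ∈ pred image
            absorb (just A) _ = X-absorbs-T A t
            inhabited : ∀ y → IsGood y → ∃ λ A → A ∈ pred P
            inhabited (just A) A∈P = A , A∈P
            φ∈T : ∀ y → φ y ∈ pred T
            φ∈T (just A) = X⊆T A
            φ∈T nothing  = C∈T (inhabited (x i) good)

        -- The decision is an argument so that facts about `combine` can be proved by matching on
        -- both outcomes.
        decide : Dec Undefined → X*
        decide (yes _)      = nothing
        decide (no defined) = just (proj₁ (value*∈X defined))

        combine : X*
        combine = decide (em _)

        star-combine⁻ : IsStar combine → Undefined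
        star-combine⁻ = go (em _)
          where
          go : ∀ d → IsStar (decide d) → Undefined
          go (yes u) _ = u

        star-combine⁺ : Undefined → IsStar combine
        star-combine⁺ u = go (em _)
          where
          go : ∀ d → IsStar (decide d)
          go (yes _)      = lift tt
          go (no defined) = contradiction u defined

        -- Once an occurrence of * is split off, the support of the remainder consists of * and of
        -- elements outside P. All of these adhere to C, and the elements adhering to C form a
        -- convex set.
        value*≋C : Undefined → value* M.≋ C
        value*≋C ((i , 0<pi , star) , ¬good) with t , s , _ , s⊆p , p≋ ← M.peel-comb p 0<pi =
          M.≋-trans (p≋ (φ ∘ x))
          (M.≋-trans
            (M.+⟨⟩-cong t (at-star (x i) star) (M.≋-refl))
          (M.≋-trans (M.+⟨⟩-comm t)
            (M.closed-support (M.Adheres-to C) (M.Adheres-to-convex C) s (φ ∘ x)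
              (λ j 0<sj → each (x j) (λ good → ¬good (j , s⊆p 0<sj , good))) (∁ t))))
          where
          rest : Weights _ → M.Carrier
          rest s = M.comb s (φ ∘ x)
          at-star : ∀ y → IsStar y → φ y M.≋ C
          at-star nothing _ = M.≋-refl
          each : ∀ y → ¬ IsGood y → M.Adheres (φ y) C
          each (just A) A∉P = adheres {A} A∉P
          each nothing  _   = λ q → M.+⟨⟩-idem C

        φ-combine : φ combine M.≋ value*
        φ-combine = go (em _)
          where
          go : ∀ d → φ (decide d) M.≋ value*
          go (yes u) = M.≋-sym (value*≋C u)
          go (no defined) = proj₂ (value*∈X defined)

        -- Primality enters here: a combination that lies in X and has no element of P in its
        -- support only involves the complement of P, which is convex.
        good-combine⁻ : IsGood combine → Good
        good-combine⁻ = go (em _) (em _)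
          where
          go : (g : Dec Good) → ∀ d → IsGood (decide d) → Good
          go (yes good) _ _ = good
          go (no ¬good) (no defined) value∈P = contradiction value∈P
            (resp (complement X P)
              (injective (M.≋-trans (ι-comb p y) (M.≋-trans (M.comb-support p (λ i 0<pi → y≋ i (real i 0<pi)))
                (M.≋-sym (proj₂ (value*∈X defined))))))
              (X.closed-support (complement X P) P-complement p y (λ i 0<pi → y∉P i (real i 0<pi))))
            where
            real = not-good⇒real defined ¬good
            -- Entries of weight zero may still be *; they are filled with an arbitrary element,
            -- here one from the support.
            A₀ : X.Carrier
            A₀ = proj₁ (real _ (proj₂ (some-positive p)))
            fill : X* → X.Carrier
            fill (just A) = A
            fill nothing  = A₀
            y : Fin _ → X.Carrier
            y = fill ∘ x
            y≋ : ∀ i → (∃ λ A → x i ≡ just A × A ∉ pred P) → ι (y i) M.≋ φ (x i)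
            y≋ i (A , xi≡ , _) =
              ≡.subst (λ z → ι (fill z) M.≋ φ z) (≡.sym xi≡) (M.≋-refl)
            y∉P : ∀ i → (∃ λ A → x i ≡ just A × A ∉ pred P) → y i ∉ pred P
            y∉P i (A , xi≡ , A∉P) = ≡.subst (λ z → fill z ∉ pred P) (≡.sym xi≡) A∉P

      good-combine⁺ : ∀ {n} (p : Weights n) x → Good p x → IsGood (combine p x)
      good-combine⁺ p x g@(i , 0<pi , good) = go (em _)
        where
        go : ∀ d → IsGood (decide p x d)
        go (yes (_ , ¬good)) = contradiction g ¬good
        go (no defined) with t , s , 0<si , _ , p≋ ← M.peel-comb p 0<pi = at (x i) good (p≋ (φ ∘ x))
          where
          -- The index i keeps positive weight in s, so the remainder meets P again and is an
          -- element of X, to which the ideal property applies.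
          rest = value*∈X s x (λ u → proj₂ u (i , 0<si , good))
          at : ∀ y → IsGood y → value* p x M.≋ φ y M.+⟨ t ⟩ value* s x →
               proj₁ (value*∈X p x defined) ∈ pred P
          at (just A) A∈P eq = resp P
            (injective (M.≋-trans (ι-comb (binary t) (pair A (proj₁ rest)))
              (M.≋-trans (M.comb-binary t (ι ∘ pair A (proj₁ rest)))
              (M.≋-trans (M.+⟨⟩-cong t M.≋-refl (proj₂ rest))
              (M.≋-trans (M.≋-sym eq) (M.≋-sym (proj₂ (value*∈X p x defined))))))))
            (P-ideal t A∈P)

      Good-cong : ∀ {n} {p q : Weights n} {x y} → (∀ i → w p i ≈ w q i) → (∀ i → x i X*.≈ y i) →
                  Good p x → Good q y
      Good-cong p≈q x≈y (i , 0<pi , good) = i , <-respʳ-≈ (p≈q i) 0<pi , IsGood-resp (x≈y i) good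

      Undefined-cong : ∀ {n} {p q : Weights n} {x y} → (∀ i → w p i ≈ w q i) → (∀ i → x i X*.≈ y i) →
                       Undefined p x → Undefined q y
      Undefined-cong {p = p} {q} {x} {y} p≈q x≈y ((i , 0<pi , star) , ¬good) =
        (i , <-respʳ-≈ (p≈q i) 0<pi , IsStar-resp (x≈y i) star) ,
        ¬good ∘ Good-cong {p = q} {p} {y} {x} (sym ∘ p≈q) (X*.sym ∘ x≈y)

      combine-cong : ∀ {n} {p q : Weights n} {x y} → (∀ i → w p i ≈ w q i) → (∀ i → x i X*.≈ y i) →
                     combine p x X*.≈ combine q y
      combine-cong {p = p} {q} {x} {y} p≈q x≈y = φ-star-injective (combine p x) (combine q y)
        (M.≋-trans (φ-combine p x)
        (M.≋-trans
          (M.comb-cong p≈q (λ i → φ-cong (x≈y i)))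
          (M.≋-sym (φ-combine q y))))
        (star-combine⁺ q y ∘ Undefined-cong {p = p} {q} {x} {y} p≈q x≈y ∘ star-combine⁻ p x)
        (star-combine⁺ p x ∘ Undefined-cong {p = q} {p} {y} {x} (sym ∘ p≈q) (X*.sym ∘ x≈y) ∘ star-combine⁻ q y)

      combine-projection : ∀ {n} (p : Weights n) x j → w p j ≈ 1# → combine p x X*.≈ x j
      combine-projection p x j pj≈1 = φ-star-injective (combine p x) (x j)
        (M.≋-trans (φ-combine p x)
          (M.projection p (φ ∘ x) j pj≈1))
        (to ∘ star-combine⁻ p x)
        (λ star → star-combine⁺ p x ((j , 0<pj , star) , λ (i , 0<pi , good) →
          star≢good (x j) star (≡.subst (λ k → IsGood (x k)) (only-j 0<pi) good)))
        where
        0<pj : Positive p j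
        0<pj = <-respʳ-≈ (sym pj≈1) 0<1
        only-j : ∀ {i} → Positive p i → i ≡ j
        only-j = concentrated p pj≈1
        star≢good : ∀ y → IsStar y → ¬ IsGood y
        star≢good nothing _ ()
        to : Undefined p x → IsStar (x j)
        to ((i , 0<pi , star) , _) = ≡.subst (λ k → IsStar (x k)) (only-j 0<pi) star

      combine-barycenter : ∀ {n m} (p : Weights n) (q : Fin (suc n) → Weights m) x →
                           combine p (λ i → combine (q i) x) X*.≈ combine (mix p q) x
      combine-barycenter p q x = φ-star-injective (combine p inner) (combine (mix p q) x)
        (M.≋-trans (φ-combine p inner)
        (M.≋-trans
          (M.comb-cong {p = p} (λ _ → refl) (λ i → φ-combine (q i) x))
        (M.≋-trans
          (M.barycenter p q (φ ∘ x))
          (M.≋-sym (φ-combine (mix p q) x)))))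
        (star-combine⁺ (mix p q) x ∘ to ∘ star-combine⁻ p inner)
        (star-combine⁺ p inner ∘ from ∘ star-combine⁻ (mix p q) x)
        where
        inner : Fin _ → X*
        inner i = combine (q i) x
        good-to : Good p inner → Good (mix p q) x
        good-to (i , 0<pi , good) with j , 0<qij , good′ ← good-combine⁻ (q i) x good =
          j , mix-positive⁺ p q 0<pi 0<qij , good′
        good-from : Good (mix p q) x → Good p inner
        good-from (j , 0<mix , good) with i , 0<pi , 0<qij ← mix-positive⁻ p q 0<mix =
          i , 0<pi , good-combine⁺ (q i) x (j , 0<qij , good)
        to : Undefined p inner → Undefined (mix p q) x
        to ((i , 0<pi , star) , ¬good) with (j , 0<qij , star′) , _ ← star-combine⁻ (q i) x star =
          (j , mix-positive⁺ p q 0<pi 0<qij , star′) , ¬good ∘ good-from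
        from : Undefined (mix p q) x → Undefined p inner
        from ((j , 0<mix , star) , ¬good) with i , 0<pi , 0<qij ← mix-positive⁻ p q 0<mix =
          (i , 0<pi , star-combine⁺ (q i) x ((j , 0<qij , star) ,
            λ (k , 0<qik , good) → ¬good (k , mix-positive⁺ p q 0<pi 0<qik , good))) ,
          ¬good ∘ good-to

    extension : OnePointExtension X
    extension = record
      { structure = record
        { comb       = combine
        ; comb-cong  = λ {_} {p} {q} {x} {y} → combine-cong {p = p} {q} {x} {y}
        ; projection = combine-projection
        ; barycenter = combine-barycenter
        }
      ; restricts = λ p x → φ-star-injective (combine p (just ∘ x)) (just (X.comb p x))
          (M.≋-trans (φ-combine p (just ∘ x)) (M.≋-sym (ι-comb p x)))
          (λ star → contradiction (proj₂ (proj₂ (proj₁ (star-combine⁻ p (just ∘ x) star)))) lower)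
          (λ ())
      }

    private module E = OnePointExtension extension

    extension-imitates : ∀ {A} → A ∈ pred P → ∀ p → ∃ λ B →
      (just A E.+⟨ p ⟩ nothing E.≋ just B) × (ι B M.≋ ι A M.+⟨ p ⟩ C)
    extension-imitates {A} A∈P p =
      from-good (combine (binary p) x) (good-combine⁺ (binary p) x (zero , 0< p , A∈P))
                (φ-combine (binary p) x)
      where
      x : Fin 2 → X*
      x = pair (just A) nothing
      from-good : ∀ y → IsGood y → φ y M.≋ value* (binary p) x →
                  ∃ λ B → y X*.≈ just B × ι B M.≋ ι A M.+⟨ p ⟩ C
      from-good (just B) _ B≋ = B , X*.refl ,
        M.≋-trans B≋
          (M.comb-binary p (φ ∘ x))

    extension-adheres : ∀ {A} → A ∉ pred P → E.Adheres (just A) nothing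
    extension-adheres {A} A∉P p = from-star (combine (binary p) x)
      (star-combine⁺ (binary p) x ((suc zero , 0< (∁ p) , lift tt) ,
        λ { (zero , _ , A∈P) → A∉P A∈P }))
      where
      x : Fin 2 → X*
      x = pair (just A) nothing
      from-star : ∀ y → IsStar y → y X*.≈ nothing
      from-star nothing _ = nothing

-- Adherence to the new point in a given extension.

module ExtensionProperties {ℓ} (R : CompleteOrderedField ℓ) {c e} (X : Convexity.ConvexAlgebra R c e) where
  open CompleteOrderedField R hiding (zero)
  open IsStrictTotalOrder isStrictTotalOrder using (<-respˡ-≈; <-respʳ-≈)
  open Convexity R
  open OrderedField R
  open WeightProperties R

  private
    module X = ConvexAlgebra X

  product : ∀ {c₁ e₁ c₂ e₂} → ConvexAlgebra c₁ e₁ → ConvexAlgebra c₂ e₂ → ConvexAlgebra (c₁ ⊔ c₂) (e₁ ⊔ e₂)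
  product Y Z = record
    { carrier   = ×-setoid Y.carrier Z.carrier
    ; structure = record
      { comb       = λ p x → Y.comb p (proj₁ ∘ x) , Z.comb p (proj₂ ∘ x)
      ; comb-cong  = λ p≈q x≋y → Y.comb-cong p≈q (proj₁ ∘ x≋y) , Z.comb-cong p≈q (proj₂ ∘ x≋y)
      ; projection = λ p x j pj≈1 → Y.projection p (proj₁ ∘ x) j pj≈1 , Z.projection p (proj₂ ∘ x) j pj≈1
      ; barycenter = λ p q x → Y.barycenter p q (proj₁ ∘ x) , Z.barycenter p q (proj₂ ∘ x)
      }
    }
    where
    module Y = ConvexAlgebra Y
    module Z = ConvexAlgebra Z

  AgreeAt : (E F : OnePointExtension X) → X.Carrier → Unit° → Set (c ⊔ e)
  AgreeAt E F A p = OnePointExtension._≋_ E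
    (OnePointExtension._+⟨_⟩_ E (just A) p nothing) (OnePointExtension._+⟨_⟩_ F (just A) p nothing)

  -- Applying `closed` to the diagonal of the product reduces arbitrary combinations
  -- to binary ones.
  ≈ᴱ-from-binary : ∀ E F → (∀ A p → AgreeAt E F A p) → E ≈ᴱ F
  ≈ᴱ-from-binary E F agree p x =
    closed E×F diagonal diagonal-convex p (λ i → x i , x i) (λ i → E.≋-refl)
    where
    module E where
      open OnePointExtension E public
      open AlgebraProperties R algebra public
    module F where
      open OnePointExtension F public
      open AlgebraProperties R algebra public
    E×F = product E.algebra F.algebra
    diagonal : Subset (ConvexAlgebra.carrier E×F) _
    diagonal = record
      { pred = λ (a , b) → a E.≋ b
      ; resp = λ (a≋a′ , b≋b′) a≋b → E.≋-trans (E.≋-sym a≋a′) (E.≋-trans a≋b b≋b′)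
      }
    binary-agree : ∀ p a b → a E.+⟨ p ⟩ b E.≋ a F.+⟨ p ⟩ b
    binary-agree p (just A) (just B) =
      E.≋-trans (E.≋-sym (E.comb-binary p (just ∘ pair A B)))
      (E.≋-trans (E.restricts (binary p) (pair A B))
      (E.≋-trans (E.≋-sym (F.restricts (binary p) (pair A B))) (F.comb-binary p (just ∘ pair A B))))
    binary-agree p (just A) nothing  = agree A p
    binary-agree p nothing  (just B) =
      E.≋-trans (E.+⟨⟩-comm p) (E.≋-trans (agree B (∁ p)) (F.≋-sym (F.+⟨⟩-comm p)))
    binary-agree p nothing  nothing  = E.≋-trans (E.+⟨⟩-idem nothing) (F.≋-sym (F.+⟨⟩-idem nothing))
    diagonal-convex : IsConvex E×F diagonal
    diagonal-convex {a , b} {a′ , b′} p a≋b a′≋b′ =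
      E.≋-trans (E.comb-binary p (proj₁ ∘ pair (a , b) (a′ , b′)))
      (E.≋-trans (E.+⟨⟩-cong p a≋b a′≋b′)
      (E.≋-trans (binary-agree p b b′)
                 (F.≋-sym (F.comb-binary p (proj₂ ∘ pair (a , b) (a′ , b′))))))

  module _ (E : OnePointExtension X) where
    open OnePointExtension E
    open AlgebraProperties R algebra

    restricts-binary : ∀ p {A B} → just A +⟨ p ⟩ just B ≋ just (A X.+⟨ p ⟩ B)
    restricts-binary p {A} {B} = ≋-trans (≋-sym (comb-binary p (just ∘ pair A B))) (restricts (binary p) (pair A B))

    *-or-real : ∀ x → x ≋ nothing ⊎ ∃ λ A → x ≋ just A
    *-or-real (just A) = inj₂ (A , ≋-refl)
    *-or-real nothing  = inj₁ ≋-refl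

    real≉* : ∀ {A} → ¬ just A ≋ nothing
    real≉* ()

    reals-closed : ∀ {A B} p → ¬ just A +⟨ p ⟩ just B ≋ nothing
    reals-closed p eq = real≉* (≋-trans (≋-sym (restricts-binary p)) eq)

    adheres-resp : ∀ {A B} → A X.≋ B → Adheres (just A) nothing → Adheres (just B) nothing
    adheres-resp A≋B = resp (Adheres-to nothing) (just A≋B)

    module _ (em : ∀ a → ExcludedMiddle a) where

      private
        Collapses : X.Carrier → Unit° → Set _
        Collapses A r = nothing +⟨ r ⟩ just A ≋ nothing

        -- If the larger weight r′ of * gave an element of X, mixing it further with A would reach
        -- the weight r without leaving X.
        collapses-mono : ∀ {A r r′} → value r ≤ value r′ → Collapses A r → Collapses A r′
        collapses-mono (inj₂ r≈r′) eq = ≋-trans (+⟨⟩-weight (sym r≈r′)) eq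
        collapses-mono {A} {r} {r′} (inj₁ r<r′) eq with *-or-real (nothing +⟨ r′ ⟩ just A)
        ... | inj₁ eq′ = eq′
        ... | inj₂ (B , eq′) with s , sr′≈r ← ratio (0< r) r<r′ =
          contradiction
            (≋-trans (+⟨⟩-cong s (≋-sym eq′) ≋-refl)
            (≋-trans (nested r′ s) (≋-trans (+⟨⟩-weight sr′≈r) eq)))
            (reals-closed s)

        collapses-square : ∀ {A r} → Collapses A r → Collapses A (r · r)
        collapses-square {r = r} eq = ≋-trans (≋-sym (nested r r)) (≋-trans (+⟨⟩-cong r eq ≋-refl) eq)

        -- 1 / (1 + x) ≤ r
        Above : ℝ → Unit° → Set ℓ
        Above x r = 1# ≤ (1# + x) * value r

      -- The weights r of * with r* + (1-r)A = * are upward closed and closed under squaring, hence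
      -- arbitrarily small. Writing r = 1/(1+x) turns squaring into doubling of x, because (1+x)² ≥
      -- 1+2x.
      collapse : ∀ {A p} → just A +⟨ p ⟩ nothing ≋ nothing → Adheres (just A) nothing
      collapse {A} {p} eq q = ≋-trans (+⟨⟩-comm q) (all (∁ q))
        where
        Q : ℝ → Set _
        Q x = ∀ r → Above x r → Collapses A r
        down : ∀ {x y} → 0# < x → x < y → Q y → Q x
        down 0<x x<y Qy r above = Qy r (≤-trans above
          (≤-respˡ (*-comm _ _) (≤-respʳ (*-comm _ _)
            (*-monoˡ-≤ (0< r) (inj₁ (<-respˡ-≈ (+-comm _ _) (<-respʳ-≈ (+-comm _ _) (+-monoˡ-< 1# x<y))))))))
        double : ∀ {x} → 0# < x → Q x → Q (x + x)
        double {x} 0<x Qx r above with y , 0<y , 1+x*y≈1 ← reciprocal (0<+ 0<1 0<x) =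
          collapses-mono {r = s · s} {r} s²≤r (collapses-square (Qx s (inj₂ (sym 1+x*y≈1))))
          where
          y+xy≈1 : y + x * y ≈ 1#
          y+xy≈1 = trans (+-congʳ (sym (*-identityˡ y))) (trans (sym (distribʳ y 1# x)) 1+x*y≈1)
          0<xy : 0# < x * y
          0<xy = *-pos 0<x 0<y
          y<1 : y < 1#
          y<1 = <-respʳ-≈ (trans (+-comm _ _) y+xy≈1) (x<y+x y 0<xy)
          s : Unit°
          s = record { value = y ; 0< = 0<y ; <1 = y<1 }
          y[1+x+x]≈1+xy : y * (1# + (x + x)) ≈ 1# + x * y
          y[1+x+x]≈1+xy = trans (*-congˡ (sym (+-assoc _ _ _))) (trans (distribˡ y _ x)
            (+-cong (trans (*-comm _ _) 1+x*y≈1) (*-comm y x)))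
          y²[1+x+x]≤1 : y * (y * (1# + (x + x))) ≤ 1#
          y²[1+x+x]≤1 = ≤-respˡ (sym (trans (*-congˡ y[1+x+x]≈1+xy) (trans (distribˡ y 1# _) (+-congʳ (*-identityʳ y)))))
            (≤-respʳ y+xy≈1 (≤-respˡ (+-comm _ _) (≤-respʳ (+-comm _ _)
              (+-monoˡ-≤ y (inj₁ (<-respˡ-≈ (*-comm _ _) (<-respʳ-≈ (*-identityʳ _) (*-monoˡ-< 0<xy y<1))))))))
          s²≤r : y * y ≤ value r
          s²≤r = ≤-trans
            (≤-respˡ (*-identityʳ _) (*-monoˡ-≤ (*-pos 0<y 0<y) above))
            (≤-respˡ (trans (*-comm _ _) (trans (*-congʳ (sym (*-assoc _ _ _))) (*-assoc _ _ _)))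
              (≤-respʳ (*-identityʳ _) (*-monoˡ-≤ (0< r) y²[1+x+x]≤1)))
        all : ∀ r → Collapses A r
        all r with y , 0<y , r*y≈1 ← reciprocal (0< r)
                 | z , 0<z , p̄*z≈1 ← reciprocal (0< (∁ p)) =
          -- The start x = 1/(1-p) - 1 encodes the given weight 1-p of *. The target x = 1/r is
          -- admissible since (1 + 1/r) r = 1 + r ≥ 1.
          archimedean-induction em Q down double 0<z-1 base 0<y r
            (≤-respʳ (sym (trans (distribʳ (value r) 1# y) (+-congˡ (trans (*-comm _ _) r*y≈1))))
              (inj₁ (x<y+x 1# (<-respʳ-≈ (sym (*-identityˡ _)) (0< r)))))
          where
          1<z : 1# < z
          1<z = <-respˡ-≈ (trans (*-comm _ _) p̄*z≈1) (<-respʳ-≈ (*-identityʳ z) (*-monoˡ-< 0<z (<1 (∁ p))))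
          0<z-1 : 0# < z - 1#
          0<z-1 = 0<y-x 1<z
          base : Q (z - 1#)
          base r′ above = collapses-mono {r = ∁ p} {r′}
            (≤-respˡ (*-identityʳ _) (≤-respʳ p̄*[zr]≈r (*-monoˡ-≤ (0< (∁ p)) above)))
            (≋-trans (≋-sym (+⟨⟩-comm p)) eq)
            where
            p̄*[zr]≈r : value (∁ p) * ((1# + (z - 1#)) * value r′) ≈ value r′
            p̄*[zr]≈r = trans (*-congˡ (*-congʳ (trans (+-comm _ _) (y-x+x≈y 1# z))))
              (trans (sym (*-assoc _ _ _)) (trans (*-congʳ p̄*z≈1) (*-identityˡ _)))

      real-combination : ∀ {A} → ¬ Adheres (just A) nothing → ∀ p → ∃ λ B → just A +⟨ p ⟩ nothing ≋ just B
      real-combination {A} ¬adh p with *-or-real (just A +⟨ p ⟩ nothing)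
      ... | inj₁ eq = contradiction (collapse eq) ¬adh
      ... | inj₂ B,eq = B,eq

      NonAdherent : Subset X.carrier (ℓ ⊔ c ⊔ e)
      NonAdherent = record
        { pred = λ A → ¬ Adheres (just A) nothing
        ; resp = λ A≋B ¬adh adh → ¬adh (adheres-resp (X.≋-sym A≋B) adh)
        }

      -- If tA + (1-t)B adhered to *, then mixing ½A + ½* with ½B + ½* at weight t would give *.
      -- When ½B + ½* lies in X, this contradicts closure of X; when it is *, a single combination
      -- of A with * collapses, and `collapse` makes A adhere. The complement is convex as the set
      -- of adhering elements.
      NonAdherent-prime : IsPrimeIdeal X NonAdherent
      NonAdherent-prime = ideal , λ {A} {B} p ¬¬adh-A ¬¬adh-B ¬adh →
        ¬adh (resp (Adheres-to nothing) (restricts-binary p)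
          (Adheres-to-convex nothing p (stable ¬¬adh-A) (stable ¬¬adh-B)))
        where
        stable : ∀ {A} → ¬ ¬ Adheres (just A) nothing → Adheres (just A) nothing
        stable {A} ¬¬adh with em _ {Adheres (just A) nothing}
        ... | yes adh = adh
        ... | no ¬adh = contradiction ¬adh ¬¬adh
        ideal : IsIdeal X NonAdherent
        ideal {A} {B} t A∈P adh with real-combination A∈P ½ | *-or-real (just B +⟨ ½ ⟩ nothing)
        ... | A′ , A′≋ | inj₁ B+*≋* =
          A∈P (collapse (≋-trans (≋-sym (nested ½ t))
            (≋-trans (+⟨⟩-cong t ≋-refl (≋-sym B+*≋*)) split)))
          where
          split : (just A +⟨ ½ ⟩ nothing) +⟨ t ⟩ (just B +⟨ ½ ⟩ nothing) ≋ nothing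
          split = ≋-trans (≋-sym (distribʳ-+⟨⟩ ½ t))
            (≋-trans (+⟨⟩-cong ½ (restricts-binary t) ≋-refl) (adh ½))
        ... | A′ , A′≋ | inj₂ (B′ , B′≋) = reals-closed t
          (≋-trans (+⟨⟩-cong t (≋-sym A′≋) (≋-sym B′≋))
          (≋-trans (≋-sym (distribʳ-+⟨⟩ ½ t))
          (≋-trans (+⟨⟩-cong ½ (restricts-binary t) ≋-refl) (adh ½))))

    -- Since qZ + (1-q)* = *, the * inside B = pA + (1-p)* absorbs any Z adhering to *. Comparing
    -- two such Z later yields translations of B.
    adherent-mixture : ∀ {A B Z} p q → just A +⟨ p ⟩ nothing ≋ just B → Adheres (just Z) nothing →
                       (A X.+⟨ p ⟩ Z) X.+⟨ q ⟩ B X.≋ B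
    adherent-mixture {A} {B} {Z} p q A+*≋B adh = drop-just
      (≋-trans (≋-sym (restricts-binary q))
      (≋-trans (+⟨⟩-cong q (≋-sym (restricts-binary p)) (≋-sym A+*≋B))
      (≋-trans (≋-sym (distribˡ-+⟨⟩ p q))
      (≋-trans (+⟨⟩-cong p ≋-refl (adh q)) A+*≋B))))

-- From one combination with * to all of them.

module Imitation {ℓ} (R : CompleteOrderedField ℓ) {c e c′ e′} {X : Convexity.ConvexAlgebra R c e}
    {M : Convexity.ConvexAlgebra R c′ e′} (embedding : Convexity.Homomorphism R X M)
    (E : Convexity.OnePointExtension R X) where
  open Convexity R
  open OrderedField R
  open Homomorphism embedding renaming (map to ι; map-cong to ι-cong; map-comb to ι-comb)
  private
    module M where
      open ConvexAlgebra M public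
      open AlgebraProperties R M public
    module X = ConvexAlgebra X
  open OnePointExtension E
  open AlgebraProperties R algebra using (distribˡ-+⟨⟩)
  open ExtensionProperties R X using (restricts-binary)

  module _ (Z : X.Carrier)
           (cancel : ∀ {a b} → ι Z M.+⟨ ½ ⟩ a M.≋ ι Z M.+⟨ ½ ⟩ b → a M.≋ b)
           {F : X.Carrier} (Z+*≋F : just Z +⟨ ½ ⟩ nothing ≋ just F)
           {C : M.Carrier} (F≋Z+C : ι F M.≋ ι Z M.+⟨ ½ ⟩ C) where

    private
      -- Substitution of C for *. At first it is known to respect only combinations within X and ½Z
      -- + ½*, which are exactly what mixing with Z produces.
      φ : Maybe X.Carrier → M.Carrier
      φ (just A) = ι A
      φ nothing  = C

      φ-cong : ∀ {x y} → x ≋ y → φ x M.≋ φ y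
      φ-cong (just A≋B) = ι-cong A≋B
      φ-cong nothing    = M.≋-refl

      real-binary : ∀ {A B} p → ι (A X.+⟨ p ⟩ B) M.≋ ι A M.+⟨ p ⟩ ι B
      real-binary {A} {B} p = M.≋-trans (ι-comb (binary p) (pair A B)) (M.comb-binary p (ι ∘ pair A B))

      φ-mix-Z : ∀ y → φ (just Z +⟨ ½ ⟩ y) M.≋ ι Z M.+⟨ ½ ⟩ φ y
      φ-mix-Z (just B) = M.≋-trans (φ-cong (restricts-binary E ½)) (real-binary {Z} {B} ½)
      φ-mix-Z nothing  = M.≋-trans (φ-cong Z+*≋F) F≋Z+C

      -- Mixing with Z turns every occurrence of * into the element F of X.
      φ-mix-* : ∀ A p → φ (just A +⟨ p ⟩ nothing) M.≋ ι A M.+⟨ p ⟩ C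
      φ-mix-* A p = cancel
        (M.≋-trans (M.≋-sym (φ-mix-Z (just A +⟨ p ⟩ nothing)))
        (M.≋-trans (φ-cong (≋-trans (distribˡ-+⟨⟩ ½ p)
          (≋-trans (+⟨⟩-cong p (restricts-binary E ½) Z+*≋F) (restricts-binary E p))))
        (M.≋-trans (real-binary {Z X.+⟨ ½ ⟩ A} {F} p)
        (M.≋-trans (M.+⟨⟩-cong p (real-binary {Z} {A} ½) F≋Z+C)
                   (M.≋-sym (M.distribˡ-+⟨⟩ ½ p))))))

    imitated : ∀ {A B p} → just A +⟨ p ⟩ nothing ≋ just B → ι B M.≋ ι A M.+⟨ p ⟩ C
    imitated {A} {B} {p} eq = M.≋-trans (M.≋-sym (φ-cong eq)) (φ-mix-* A p)

    adherent⇒adheres : ∀ {A} → Adheres (just A) nothing → M.Adheres (ι A) C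
    adherent⇒adheres {A} adh p = M.≋-trans (M.≋-sym (φ-mix-* A p)) (φ-cong (adh p))

-- Cancellation and motion along rays in a vector space.

module VectorProperties {ℓ} (R : CompleteOrderedField ℓ) (V : VectorSpace R) where
  open CompleteOrderedField R hiding (zero)
  open Convexity R
  open OrderedField R
  open Module V
  open Algebra.Properties.Semiring.Sum semiring using () renaming (sum to sumᴿ)
  open Algebra.Properties.AbelianGroup +ᴹ-abelianGroup using (∙-cancelˡ; x∙y⁻¹≈ε⇒x≈y; xyx⁻¹≈y)
  open Algebra.Properties.CommutativeSemigroup (CommutativeMonoid.commutativeSemigroup +ᴹ-commutativeMonoid)
    using (xy∙z≈xz∙y)
  open Algebra.Properties.CommutativeMonoid.Sum +ᴹ-commutativeMonoid using () renaming (sum to sumᴹ)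
  open ConvexAlgebra (vectorAlgebra V) using (_+⟨_⟩_; carrier; ≋-sym; ≋-trans)
  open Relation.Binary.Reasoning.Setoid carrier

  mix≈ : ∀ p {a b} → a +⟨ p ⟩ b ≈ᴹ value p *ₗ a +ᴹ value (∁ p) *ₗ b
  mix≈ p = +ᴹ-congˡ (+ᴹ-identityʳ _)

  *ₗ-inverse : ∀ {r s} v → r * s ≈ 1# → r *ₗ (s *ₗ v) ≈ᴹ v
  *ₗ-inverse v rs≈1 = ≋-trans (≋-sym (*ₗ-assoc _ _ v)) (≋-trans (*ₗ-congʳ rs≈1) (*ₗ-identityˡ v))

  *ₗ-cancel : ∀ {r v u} → 0# < r → r *ₗ v ≈ᴹ r *ₗ u → v ≈ᴹ u
  *ₗ-cancel 0<r rv≈ru with s , _ , rs≈1 ← reciprocal 0<r =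
    ≋-trans (≋-sym (*ₗ-inverse _ sr≈1)) (≋-trans (*ₗ-congˡ rv≈ru) (*ₗ-inverse _ sr≈1))
    where sr≈1 = trans (*-comm s _) rs≈1

  +⟨⟩-cancelˡ : ∀ p {x a b} → x +⟨ p ⟩ a ≈ᴹ x +⟨ p ⟩ b → a ≈ᴹ b
  +⟨⟩-cancelˡ p eq = *ₗ-cancel (0< (∁ p))
    (∙-cancelˡ _ _ _ (≋-trans (≋-sym (mix≈ p)) (≋-trans eq (mix≈ p))))

  x+[v-x]≈v : ∀ x v → x +ᴹ (v +ᴹ -ᴹ x) ≈ᴹ v
  x+[v-x]≈v x v = begin
    x +ᴹ (v +ᴹ -ᴹ x)   ≈⟨ +ᴹ-comm _ _ ⟩
    v +ᴹ -ᴹ x +ᴹ x     ≈⟨ +ᴹ-assoc _ _ _ ⟩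
    v +ᴹ (-ᴹ x +ᴹ x)   ≈⟨ +ᴹ-congˡ (-ᴹ‿inverseˡ x) ⟩
    v +ᴹ 0ᴹ            ≈⟨ +ᴹ-identityʳ v ⟩
    v                  ∎

  +⟨⟩-solve : ∀ p x v → ∃ λ a → x +⟨ p ⟩ a ≈ᴹ v
  +⟨⟩-solve p x v with s , _ , p̄s≈1 ← reciprocal (0< (∁ p)) = s *ₗ (v +ᴹ -ᴹ (value p *ₗ x)) , (begin
    x +⟨ p ⟩ (s *ₗ (v +ᴹ -ᴹ (value p *ₗ x)))                            ≈⟨ mix≈ p ⟩
    value p *ₗ x +ᴹ value (∁ p) *ₗ (s *ₗ (v +ᴹ -ᴹ (value p *ₗ x)))      ≈⟨ +ᴹ-congˡ (*ₗ-inverse _ p̄s≈1) ⟩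
    value p *ₗ x +ᴹ (v +ᴹ -ᴹ (value p *ₗ x))                            ≈⟨ x+[v-x]≈v _ v ⟩
    v                                                                    ∎)

  difference≈0⇒≈ : ∀ {a b} → a +ᴹ -ᴹ b ≈ᴹ 0ᴹ → a ≈ᴹ b
  difference≈0⇒≈ = x∙y⁻¹≈ε⇒x≈y _ _

  *ₗ-swap : ∀ r s v → r *ₗ (s *ₗ v) ≈ᴹ s *ₗ (r *ₗ v)
  *ₗ-swap r s v = ≋-trans (≋-sym (*ₗ-assoc r s v)) (≋-trans (*ₗ-congʳ (*-comm r s)) (*ₗ-assoc s r v))

  +⟨⟩-shiftʳ : ∀ p {a b v} → a +⟨ p ⟩ (b +ᴹ v) ≈ᴹ (a +⟨ p ⟩ b) +ᴹ value (∁ p) *ₗ v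
  +⟨⟩-shiftʳ p {a} {b} {v} = begin
    a +⟨ p ⟩ (b +ᴹ v)                                         ≈⟨ mix≈ p ⟩
    value p *ₗ a +ᴹ value (∁ p) *ₗ (b +ᴹ v)                   ≈⟨ +ᴹ-congˡ (*ₗ-distribˡ _ b v) ⟩
    value p *ₗ a +ᴹ (value (∁ p) *ₗ b +ᴹ value (∁ p) *ₗ v)    ≈⟨ +ᴹ-assoc _ _ _ ⟨
    value p *ₗ a +ᴹ value (∁ p) *ₗ b +ᴹ value (∁ p) *ₗ v      ≈⟨ +ᴹ-congʳ (mix≈ p {a} {b}) ⟨
    (a +⟨ p ⟩ b) +ᴹ value (∁ p) *ₗ v                          ∎

  +⟨⟩-shiftˡ : ∀ p {a b v} → (a +ᴹ v) +⟨ p ⟩ b ≈ᴹ (a +⟨ p ⟩ b) +ᴹ value p *ₗ v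
  +⟨⟩-shiftˡ p {a} {b} {v} = begin
    (a +ᴹ v) +⟨ p ⟩ b                                    ≈⟨ mix≈ p ⟩
    value p *ₗ (a +ᴹ v) +ᴹ value (∁ p) *ₗ b              ≈⟨ +ᴹ-congʳ (*ₗ-distribˡ _ a v) ⟩
    value p *ₗ a +ᴹ value p *ₗ v +ᴹ value (∁ p) *ₗ b     ≈⟨ xy∙z≈xz∙y _ _ _ ⟩
    value p *ₗ a +ᴹ value (∁ p) *ₗ b +ᴹ value p *ₗ v     ≈⟨ +ᴹ-congʳ (mix≈ p {a} {b}) ⟨
    (a +⟨ p ⟩ b) +ᴹ value p *ₗ v                         ∎

  sum-*ₗ : ∀ {n} (t : Fin n → ℝ) (s : Fin n → ℝ) v →
           sumᴿ (λ i → t i * s i) *ₗ v ≈ᴹ sumᴹ (λ i → t i *ₗ (s i *ₗ v))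
  sum-*ₗ {zero}  t s v = *ₗ-zeroˡ v
  sum-*ₗ {suc n} t s v = ≋-trans (*ₗ-distribʳ v _ _)
    (+ᴹ-cong (*ₗ-assoc _ _ v) (sum-*ₗ (t ∘ suc) (s ∘ suc) v))

  scale : Carrierᴹ → Homomorphism ℝ⁺ (vectorAlgebra V)
  scale v = record
    { map      = λ s → proj₁ s *ₗ v
    ; map-cong = *ₗ-congʳ
    ; map-comb = λ p x → sum-*ₗ (w p) (proj₁ ∘ x) v
    }

  double-mid : ∀ {a t v} → a +⟨ ½ ⟩ (a +ᴹ (t + t) *ₗ v) ≈ᴹ a +ᴹ t *ₗ v
  double-mid {a} {t} {v} = ≋-trans (+⟨⟩-shiftʳ ½)
    (+ᴹ-cong (AlgebraProperties.+⟨⟩-idem R (vectorAlgebra V) {½} a)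
      (≋-trans (≋-sym (*ₗ-assoc _ _ v)) (*ₗ-congʳ half)))
    where
    half : (1# - value ½) * (t + t) ≈ t
    half = trans (*-congʳ 1-½≈½) (trans (distribˡ _ t t) (trans (sym (distribʳ t _ _))
      (trans (*-congʳ ½+½≈1) (*-identityˡ t))))

  -- The weight is `∁ s` because it belongs to the base point a, while s scales the displacement.
  segment : ∀ {a s t t′} {v} → value s * t ≈ t′ → a +⟨ ∁ s ⟩ (a +ᴹ t *ₗ v) ≈ᴹ a +ᴹ t′ *ₗ v
  segment {a} {s} {t} {t′} {v} st≈t′ = ≋-trans (+⟨⟩-shiftʳ (∁ s))
    (+ᴹ-cong (AlgebraProperties.+⟨⟩-idem R (vectorAlgebra V) {∁ s} a)
      (≋-trans (≋-sym (*ₗ-assoc _ _ v))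
        (*ₗ-congʳ (trans (*-congʳ (1-[1-x]≈x (value s))) st≈t′))))

  -- The shift by 1 keeps both parameters positive for every s > 0, so both points lie on the open
  -- ray.
  ray-difference : ∀ b s v → s *ₗ v ≈ᴹ (b +ᴹ (s + 1#) *ₗ v) +ᴹ -ᴹ (b +ᴹ 1# *ₗ v)
  ray-difference b s v = ≋-sym (≋-trans (+ᴹ-congʳ regroup) (xyx⁻¹≈y (b +ᴹ 1# *ₗ v) (s *ₗ v)))
    where
    regroup : b +ᴹ (s + 1#) *ₗ v ≈ᴹ b +ᴹ 1# *ₗ v +ᴹ s *ₗ v
    regroup = ≋-trans (+ᴹ-congˡ (≋-trans (*ₗ-distribʳ v s 1#) (+ᴹ-comm _ _))) (≋-sym (+ᴹ-assoc _ _ _))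

  doubling-fixed⇒0 : ∀ v → 1# *ₗ v ≈ᴹ (1# + 1#) *ₗ v → v ≈ᴹ 0ᴹ
  doubling-fixed⇒0 v eq = ≋-sym (∙-cancelˡ v 0ᴹ v (≋-trans (+ᴹ-identityʳ v)
    (≋-trans (≋-sym (*ₗ-identityˡ v)) (≋-trans eq (≋-trans (*ₗ-distribʳ v 1# 1#)
      (+ᴹ-cong (*ₗ-identityˡ v) (*ₗ-identityˡ v)))))))

-- Adherence and cancellation for convex sets.

module ConvexSetProperties {ℓ} (R : CompleteOrderedField ℓ) (V : VectorSpace R) where
  open CompleteOrderedField R hiding (zero)
  open Convexity R
  open OrderedField R
  open VectorProperties R V
  open Module V
  private
    𝕍 = vectorAlgebra V
    module 𝕍 where
      open ConvexAlgebra 𝕍 public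
      open AlgebraProperties R 𝕍 public
  open ConvexAlgebra (Pc 𝕍) using (_≋_; _+⟨_⟩_; Adheres)
  open 𝕍 using () renaming (_+⟨_⟩_ to _⊕⟨_⟩_)

  abstract
    +⟨⟩-∈⁺ : ∀ {A B p a b} → a ∈ elements A → b ∈ elements B → a ⊕⟨ p ⟩ b ∈ elements (A +⟨ p ⟩ B)
    +⟨⟩-∈⁺ {a = a} {b} a∈A b∈B = pair a b , (λ { zero → a∈A ; (suc _) → b∈B }) , 𝕍.≋-refl

    +⟨⟩-∈⁻ : ∀ {A B p v} → v ∈ elements (A +⟨ p ⟩ B) →
             ∃ λ a → ∃ λ b → a ∈ elements A × b ∈ elements B × v ≈ᴹ a ⊕⟨ p ⟩ b
    +⟨⟩-∈⁻ {p = p} (a , a∈ , v≋) =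
      a zero , a (suc zero) , a∈ zero , a∈ (suc zero) , 𝕍.≋-trans v≋ (𝕍.comb-binary p a)

  singleton-mix-∈⁻ : ∀ {x B p v} → v ∈ elements (｛_｝ 𝕍 x +⟨ p ⟩ B) →
                     ∃ λ b → b ∈ elements B × v ≈ᴹ x ⊕⟨ p ⟩ b
  singleton-mix-∈⁻ {x} {B} {p} v∈ with x′ , b , x′≈x , b∈B , eq ← +⟨⟩-∈⁻ {｛_｝ 𝕍 x} {B} {p} v∈ =
    b , b∈B , 𝕍.≋-trans eq (𝕍.+⟨⟩-cong p x′≈x 𝕍.≋-refl)

  singleton-mix-∈⁺ : ∀ {x B p b} → b ∈ elements B → x ⊕⟨ p ⟩ b ∈ elements (｛_｝ 𝕍 x +⟨ p ⟩ B)
  singleton-mix-∈⁺ {x} {B} {p} = +⟨⟩-∈⁺ {｛_｝ 𝕍 x} {B} {p} 𝕍.≋-refl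

  -- The vector px + (1-p)b determines b once x is fixed. Larger sets need not cancel: `everything`
  -- swallows whatever it is mixed with.
  singleton-cancel : ∀ p {x A B} → ｛_｝ 𝕍 x +⟨ p ⟩ A ≋ ｛_｝ 𝕍 x +⟨ p ⟩ B → A ≋ B
  singleton-cancel p {x} {A} {B} (to , from) = half {A} {B} to , half {B} {A} from
    where
    half : ∀ {A B} → elements (｛_｝ 𝕍 x +⟨ p ⟩ A) ⊆ elements (｛_｝ 𝕍 x +⟨ p ⟩ B) → elements A ⊆ elements B
    half {A} {B} sub {a} a∈A with b , b∈B , eq ← singleton-mix-∈⁻ {x} {B} {p} (sub (singleton-mix-∈⁺ {x} {A} {p} a∈A)) =
      resp (subset B) (𝕍.≋-sym (+⟨⟩-cancelˡ p eq)) b∈B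

  module _ (p : Unit°) (x : Carrierᴹ) (F : ConvexSet 𝕍) where

    -- The set C with F = p x + (1 - p) C.
    quotient : ConvexSet 𝕍
    quotient = record
      { subset   = record
        { pred = λ v → x ⊕⟨ p ⟩ v ∈ elements F
        ; resp = λ u≈v → resp (subset F) (𝕍.+⟨⟩-cong p 𝕍.≋-refl u≈v)
        }
      ; nonempty = let f , f∈F = nonempty F ; v , eq = +⟨⟩-solve p x f in
                   v , resp (subset F) (𝕍.≋-sym eq) f∈F
      ; convex   = λ q u∈ v∈ → resp (subset F) (𝕍.≋-sym (𝕍.distribˡ-+⟨⟩ p q)) (convex F q u∈ v∈)
      }

    quotient-mix : F ≋ ｛_｝ 𝕍 x +⟨ p ⟩ quotient
    quotient-mix = to , from
      where
      to : elements F ⊆ elements (｛_｝ 𝕍 x +⟨ p ⟩ quotient)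
      to {f} f∈F with v , eq ← +⟨⟩-solve p x f =
        resp (subset (｛_｝ 𝕍 x +⟨ p ⟩ quotient)) eq
          (singleton-mix-∈⁺ {x} {quotient} {p} (resp (subset F) (𝕍.≋-sym eq) f∈F))
      from : elements (｛_｝ 𝕍 x +⟨ p ⟩ quotient) ⊆ elements F
      from v∈ with b , b∈ , eq ← singleton-mix-∈⁻ {x} {quotient} {p} v∈ =
        resp (subset F) (𝕍.≋-sym eq) b∈

  everything : ConvexSet 𝕍
  everything = record
    { subset   = record { pred = λ _ → Lift ℓ ⊤ ; resp = λ _ _ → lift tt }
    ; nonempty = 0ᴹ , lift tt
    ; convex   = λ _ _ _ → lift tt
    }

  adheres-everything : ∀ A → Adheres A everything
  adheres-everything A p = (λ _ → lift tt) , λ {v} _ →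
    let a , a∈A = nonempty A ; b , eq = +⟨⟩-solve p a v
    in resp (subset (A +⟨ p ⟩ everything)) eq (+⟨⟩-∈⁺ {A} {everything} {p} a∈A (lift tt))

  module _ (em : ∀ a → ExcludedMiddle a) where

    -- Adherence is an equality of sets. One inclusion moves points of C towards a; the other, at
    -- weight ½, writes a point of C as the midpoint of a and another point of C, which doubles its
    -- displacement from a.
    cone : ∀ {a c} C → Adheres (｛_｝ 𝕍 a) C → c ∈ elements C →
           ∀ {t} → 0# < t → a +ᴹ t *ₗ (c +ᴹ -ᴹ a) ∈ elements C
    cone {a} {c} C adh c∈C = archimedean-induction em Q down double 0<1
      (resp (subset C) (𝕍.≋-sym (𝕍.≋-trans (+ᴹ-congˡ (*ₗ-identityˡ v)) (x+[v-x]≈v a c))) c∈C)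
      where
      v : Carrierᴹ
      v = c +ᴹ -ᴹ a
      Q : ℝ → Set ℓ
      Q t = a +ᴹ t *ₗ v ∈ elements C
      down : ∀ {t t′} → 0# < t → t < t′ → Q t′ → Q t
      down 0<t t<t′ q with s , st′≈t ← ratio 0<t t<t′ = resp (subset C) (segment {s = s} st′≈t)
        (proj₁ (adh (∁ s)) (singleton-mix-∈⁺ {a} {C} {∁ s} q))
      double : ∀ {t} → 0# < t → Q t → Q (t + t)
      double {t} _ q with c′ , c′∈C , eq ← singleton-mix-∈⁻ {a} {C} {½} (proj₂ (adh ½) q) =
        resp (subset C) (+⟨⟩-cancelˡ ½ (𝕍.≋-trans (𝕍.≋-sym eq) (𝕍.≋-sym double-mid))) c′∈C

    -- b = ½ (p a + (1 - p) x) + ½ b′ is moved in the direction y - x by replacing x with y.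
    translation : ∀ {A x y} p {M N} B → M ≋ A +⟨ p ⟩ ｛_｝ 𝕍 x → N ≋ A +⟨ p ⟩ ｛_｝ 𝕍 y →
      Adheres M B → Adheres N B →
      ∀ {t} → 0# < t → ∀ {b} → b ∈ elements B → b +ᴹ t *ₗ (y +ᴹ -ᴹ x) ∈ elements B
    translation {A} {x} {y} p {M} {N} B M≋ N≋ M-adh N-adh 0<t b∈B =
      archimedean-induction em Q down double (*-pos (0< ½) (0< (∁ p))) base 0<t b∈B
      where
      v : Carrierᴹ
      v = y +ᴹ -ᴹ x
      Q : ℝ → Set ℓ
      Q t = ∀ {b} → b ∈ elements B → b +ᴹ t *ₗ v ∈ elements B
      down : ∀ {t t′} → 0# < t → t < t′ → Q t′ → Q t
      down 0<t t<t′ q b∈B with s , st′≈t ← ratio 0<t t<t′ =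
        resp (subset B) (segment {s = s} st′≈t) (convex B (∁ s) b∈B (q b∈B))
      double : ∀ {t} → 0# < t → Q t → Q (t + t)
      double {t} _ q b∈B = resp (subset B)
        (𝕍.≋-trans (+ᴹ-assoc _ _ _) (+ᴹ-congˡ (𝕍.≋-sym (*ₗ-distribʳ v t t)))) (q (q b∈B))
      move : ∀ a b′ → (a ⊕⟨ p ⟩ y) ⊕⟨ ½ ⟩ b′ ≈ᴹ ((a ⊕⟨ p ⟩ x) ⊕⟨ ½ ⟩ b′) +ᴹ (value ½ * value (∁ p)) *ₗ v
      move a b′ =
        𝕍.≋-trans (𝕍.+⟨⟩-cong ½ (𝕍.≋-trans (𝕍.+⟨⟩-cong p 𝕍.≋-refl (𝕍.≋-sym (x+[v-x]≈v x y)))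
          (+⟨⟩-shiftʳ p)) 𝕍.≋-refl)
        (𝕍.≋-trans (+⟨⟩-shiftˡ ½) (+ᴹ-congˡ (𝕍.≋-sym (*ₗ-assoc _ _ v))))
      base : Q (value ½ * value (∁ p))
      base b∈B =
        let z , b′ , z∈ , b′∈B , b≈ = +⟨⟩-∈⁻ {M} {B} {½} (proj₂ (M-adh ½) b∈B)
            a , x′ , a∈A , x′≈x , z≈ = +⟨⟩-∈⁻ {A} {｛_｝ 𝕍 x} {p} (proj₁ M≋ z∈)
        in resp (subset B)
          (𝕍.≋-trans (move a b′) (+ᴹ-congʳ (𝕍.≋-sym (𝕍.≋-trans b≈
            (𝕍.+⟨⟩-cong ½ (𝕍.≋-trans z≈ (𝕍.+⟨⟩-cong p 𝕍.≋-refl x′≈x)) 𝕍.≋-refl)))))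
          (proj₁ (N-adh ½) (+⟨⟩-∈⁺ {N} {B} {½}
            (proj₂ N≋ (+⟨⟩-∈⁺ {A} {｛_｝ 𝕍 y} {p} a∈A 𝕍.≋-refl)) b′∈B))

-- X stands for 𝒫_c 𝔻, known only through its embedding ι into 𝒫_c 𝕍: with the concrete
-- subalgebra in its place, conversion checking unfolds the proofs stored in its elements.
module Representation {ℓ} (em : ∀ a → ExcludedMiddle a) (R : CompleteOrderedField ℓ) (V : VectorSpace R)
    (D : Subset (Module.≈ᴹ-setoid V) ℓ)
    (D-convex : Convexity.IsConvex R (Convexity.vectorAlgebra R V) D)
    {c e} (X : Convexity.ConvexAlgebra R c e)
    (ι : Convexity.ConvexAlgebra.Carrier X → Convexity.ConvexSet R (Convexity.vectorAlgebra R V))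
    (ι-cong : ∀ {A B} → Convexity.ConvexAlgebra._≋_ X A B →
              Convexity.ConvexAlgebra._≋_ (Convexity.Pc R (Convexity.vectorAlgebra R V)) (ι A) (ι B))
    (injective : ∀ {A B} → Convexity.ConvexAlgebra._≋_ (Convexity.Pc R (Convexity.vectorAlgebra R V)) (ι A) (ι B) →
                 Convexity.ConvexAlgebra._≋_ X A B)
    (ι-comb : ∀ {n} (p : Convexity.Weights R n) A → Convexity.ConvexAlgebra._≋_ (Convexity.Pc R (Convexity.vectorAlgebra R V))
                (ι (Convexity.ConvexAlgebra.comb X p A))
                (Convexity.ConvexAlgebra.comb (Convexity.Pc R (Convexity.vectorAlgebra R V)) p (ι ∘ A)))
    (ι⊆D : ∀ A → Convexity.elements (ι A) ⊆ pred D)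
    (realize : ∀ B → Convexity.elements B ⊆ pred D →
               ∃ λ A → Convexity.ConvexAlgebra._≋_ (Convexity.Pc R (Convexity.vectorAlgebra R V)) (ι A) B)
    where
  open CompleteOrderedField R hiding (zero)
  open Convexity R
  open OrderedField R
  open VectorProperties R V
  open ConvexSetProperties R V
  open Module V using (Carrierᴹ; _≈ᴹ_; _+ᴹ_; -ᴹ_; _*ₗ_; 0ᴹ)

  stable : ∀ {a} {A : Set a} → ¬ ¬ A → A
  stable {A = A} ¬¬a with em _ {A}
  ... | yes a = a
  ... | no ¬a = contradiction ¬a ¬¬a

  private
    𝕍 = vectorAlgebra V
    module 𝕍 where
      open ConvexAlgebra 𝕍 public
      open AlgebraProperties R 𝕍 public
    module Pc where
      open ConvexAlgebra (Pc 𝕍) public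
      open AlgebraProperties R (Pc 𝕍) public
    module X = ConvexAlgebra X

    embedding : Homomorphism X (Pc 𝕍)
    embedding = record { map = ι ; map-cong = ι-cong ; map-comb = ι-comb }

    Vis-resp : ∀ {x y} → x 𝕍.≋ y → x ∈ Vis 𝕍 (pred D) → y ∈ Vis 𝕍 (pred D)
    Vis-resp x≋y vis a∈D p = resp D (𝕍.+⟨⟩-cong p x≋y 𝕍.≋-refl) (vis a∈D p)

    -- These sets play the role of T: visibility is what keeps pA + (1-p)B inside D for every A in
    -- X.
    inVis : Subset Pc.carrier ℓ
    inVis = record
      { pred = λ A → elements A ⊆ Vis 𝕍 (pred D)
      ; resp = λ A≋B A⊆ x∈B → A⊆ (proj₂ A≋B x∈B)
      }

    inVis-convex : IsConvex (Pc 𝕍) inVis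
    inVis-convex {A} {B} q A⊆ B⊆ v∈ =
      let a , b , a∈A , b∈B , v≋ = +⟨⟩-∈⁻ {A} {B} {q} v∈ in
      Vis-resp (𝕍.≋-sym v≋) λ d∈D p →
        resp D (𝕍.≋-sym (𝕍.distribʳ-+⟨⟩ p q)) (D-convex q (A⊆ a∈A d∈D p) (B⊆ b∈B d∈D p))

    D⊆Vis : pred D ⊆ Vis 𝕍 (pred D)
    D⊆Vis x∈D a∈D p = D-convex p x∈D a∈D

    absorbs-Vis : ∀ A {B} p → B ∈ pred inVis → ∃ λ F → ι F Pc.≋ ι A Pc.+⟨ p ⟩ B
    absorbs-Vis A {B} p B⊆Vis = realize (ι A Pc.+⟨ p ⟩ B) λ v∈ →
      let a , b , a∈A , b∈B , v≋ = +⟨⟩-∈⁻ {ι A} {B} {p} v∈ in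
      resp D (𝕍.≋-sym (𝕍.≋-trans v≋ (𝕍.+⟨⟩-comm p))) (B⊆Vis b∈B (ι⊆D A a∈A) (∁ p))

    module Build = Construction em R X (Pc 𝕍) embedding injective
      inVis (λ {A} {B} → inVis-convex {A} {B}) (λ A a∈A → D⊆Vis (ι⊆D A a∈A)) absorbs-Vis

    ⊆singleton⇒≋ : ∀ {v} (A : ConvexSet 𝕍) → (∀ {a} → a ∈ elements A → a 𝕍.≋ v) → A Pc.≋ ｛_｝ 𝕍 v
    ⊆singleton⇒≋ A A⊆ = A⊆ , λ x≋v → let a , a∈A = nonempty A in
      resp (subset A) (𝕍.≋-sym (𝕍.≋-trans x≋v (𝕍.≋-sym (A⊆ a∈A)))) a∈A

    ι-binary : ∀ A B p → ι (A X.+⟨ p ⟩ B) Pc.≋ ι A Pc.+⟨ p ⟩ ι B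
    ι-binary A B p = Pc.≋-trans {ι (A X.+⟨ p ⟩ B)} {Pc.comb (binary p) (ι ∘ pair A B)} {ι A Pc.+⟨ p ⟩ ι B}
      (ι-comb (binary p) (pair A B)) (Pc.comb-binary p (ι ∘ pair A B))

  module _ (E : OnePointExtension X) where
    open OnePointExtension E

    ImitatesOn : ∀ {s} → ConvexSet 𝕍 → Pred X.Carrier s → Set _
    ImitatesOn C Q = ∀ {A} → A ∈ Q → ∀ p → ∃ λ B →
      (just A +⟨ p ⟩ nothing ≋ just B) × (ι B Pc.≋ ι A Pc.+⟨ p ⟩ C)

    AdheresTo* : X.Carrier → Set _
    AdheresTo* A = Adheres (just A) nothing

  -- Existence for the four prescriptions.

  ExtremalIn-D : Carrierᴹ → Set ℓ
  ExtremalIn-D v = ∀ x y p → x ∈ pred D → y ∈ pred D → x 𝕍.+⟨ p ⟩ y 𝕍.≋ v → x 𝕍.≋ v × y 𝕍.≋ v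

  blackHole-extension : ∃ λ E → ∀ A → AdheresTo* E A
  blackHole-extension = B.extension , λ A → B.extension-adheres {A} (λ ())
    where
    P : Subset X.carrier ℓ
    P = record { pred = λ _ → Lift ℓ ⊥ ; resp = λ _ () }
    P-prime : IsPrimeIdeal X P
    P-prime = (λ _ ()) , λ _ _ _ ()
    no-elements : (∃ λ A → A ∈ pred P) → everything ∈ pred inVis
    no-elements ()
    module B = Build.Extend P P-prime everything no-elements (λ {A} _ → adheres-everything (ι A))

  imitate-extension : ∀ C → elements C ⊆ Vis 𝕍 (pred D) → ∃ λ E → ImitatesOn E C U
  imitate-extension C C⊆Vis = B.extension , λ {A} _ → B.extension-imitates {A} (lift tt)
    where
    P : Subset X.carrier ℓ
    P = record { pred = λ _ → Lift ℓ ⊤ ; resp = λ _ _ → lift tt }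
    P-prime : IsPrimeIdeal X P
    P-prime = (λ _ _ → lift tt) , λ _ A∉P → contradiction (lift tt) A∉P
    module B = Build.Extend P P-prime C (λ _ → C⊆Vis) (λ A∉P → contradiction (lift tt) A∉P)

  prime-extension : ∀ {s} (P : Subset X.carrier s) → IsPrimeIdeal X P → ∀ C → elements C ⊆ Vis 𝕍 (pred D) →
    (∀ {A} → A ∉ pred P → Pc.Adheres (ι A) C) →
    ∃ λ E → ImitatesOn E C (pred P) × (∀ {A} → A ∉ pred P → AdheresTo* E A)
  prime-extension P P-prime C C⊆Vis adheres =
    B.extension , (λ {A} → B.extension-imitates {A}) , (λ {A} → B.extension-adheres {A})
    where
    module B = Build.Extend P P-prime C (λ _ → C⊆Vis) (λ {A} → adheres {A})

  -- Here P consists of all sets except {v}. Extremality makes it an ideal, as pA + (1-p)B = {v}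
  -- forces A = {v}; the complement contains only {v} and is convex by idempotency.
  extremal-extension : ∀ {v} → v ∈ pred D → ExtremalIn-D v →
    ∃ λ E → ImitatesOn E (｛_｝ 𝕍 v) (λ A → ¬ ι A Pc.≋ ｛_｝ 𝕍 v) ×
            (∀ {A} → ι A Pc.≋ ｛_｝ 𝕍 v → AdheresTo* E A)
  extremal-extension {v} v∈D extreme = let E , imitates , adheres = base in
    E , (λ {A} → imitates {A}) , λ {A} A≋⟨v⟩ → adheres {A} (λ A≉⟨v⟩ → A≉⟨v⟩ A≋⟨v⟩)
    where
    ⟨v⟩ : ConvexSet 𝕍
    ⟨v⟩ = ｛_｝ 𝕍 v
    P : Subset X.carrier ℓ
    P = record
      { pred = λ A → ¬ ι A Pc.≋ ⟨v⟩
      ; resp = λ {A} {B} A≋B A≉⟨v⟩ B≋⟨v⟩ → A≉⟨v⟩ (Pc.≋-trans {ι A} {ι B} {⟨v⟩} (ι-cong A≋B) B≋⟨v⟩)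
      }
    mix≋⟨v⟩ : ∀ A B p → ι A Pc.≋ ⟨v⟩ → ι B Pc.≋ ⟨v⟩ → ι A Pc.+⟨ p ⟩ ι B Pc.≋ ⟨v⟩
    mix≋⟨v⟩ A B p A≋⟨v⟩ B≋⟨v⟩ = Pc.≋-trans {ι A Pc.+⟨ p ⟩ ι B} {⟨v⟩ Pc.+⟨ p ⟩ ⟨v⟩} {⟨v⟩}
      (Pc.+⟨⟩-cong {ι A} {⟨v⟩} {ι B} {⟨v⟩} p A≋⟨v⟩ B≋⟨v⟩) (Pc.+⟨⟩-idem {p} ⟨v⟩)
    ⟨v⟩-adheres : ∀ A → ι A Pc.≋ ⟨v⟩ → Pc.Adheres (ι A) ⟨v⟩
    ⟨v⟩-adheres A A≋⟨v⟩ p = Pc.≋-trans {ι A Pc.+⟨ p ⟩ ⟨v⟩} {⟨v⟩ Pc.+⟨ p ⟩ ⟨v⟩} {⟨v⟩}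
      (Pc.+⟨⟩-cong {ι A} {⟨v⟩} {⟨v⟩} {⟨v⟩} p A≋⟨v⟩ (Pc.≋-refl {⟨v⟩})) (Pc.+⟨⟩-idem {p} ⟨v⟩)
    ideal : IsIdeal X P
    ideal {A} {B} p A≉⟨v⟩ A+B≋⟨v⟩ = A≉⟨v⟩ (⊆singleton⇒≋ (ι A) λ {a} a∈A →
      let b , b∈B = nonempty (ι B)
          a+b∈ = proj₂ (ι-binary A B p) (+⟨⟩-∈⁺ {ι A} {ι B} {p} a∈A b∈B)
      in proj₁ (extreme a b p (ι⊆D A a∈A) (ι⊆D B b∈B) (proj₁ A+B≋⟨v⟩ a+b∈)))
    co-convex : IsConvex X (complement X P)
    co-convex {A} {B} p ¬A≉⟨v⟩ ¬B≉⟨v⟩ A+B≉⟨v⟩ = A+B≉⟨v⟩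
      (Pc.≋-trans {ι (A X.+⟨ p ⟩ B)} {ι A Pc.+⟨ p ⟩ ι B} {⟨v⟩} (ι-binary A B p)
        (mix≋⟨v⟩ A B p (stable ¬A≉⟨v⟩) (stable ¬B≉⟨v⟩)))
    base = prime-extension P ((λ {A} {B} → ideal {A} {B}) , (λ {A} {B} → co-convex {A} {B})) ⟨v⟩
      (λ x≋v → Vis-resp (𝕍.≋-sym x≋v) (D⊆Vis v∈D)) (λ {A} ¬≉ → ⟨v⟩-adheres A (stable ¬≉))

  -- Uniqueness of the extension and of the imitated set.

  private
    module XE = ExtensionProperties R X

    just-injective : ∀ {A B} (E : OnePointExtension X) → OnePointExtension._≋_ E (just A) (just B) → ι A Pc.≋ ι B
    just-injective E eq = ι-cong (drop-just eq)

  imitations-agree : ∀ E F {C s s′} {Q : Pred X.Carrier s} {Q′ : Pred X.Carrier s′} →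
    ImitatesOn E C Q → ImitatesOn F C Q′ → ∀ {A} → A ∈ Q → A ∈ Q′ → ∀ p → XE.AgreeAt E F A p
  imitations-agree E F {C} imitates imitates′ {A} A∈Q A∈Q′ p =
    let B , eq , B≋ = imitates A∈Q p ; B′ , eq′ , B′≋ = imitates′ A∈Q′ p in
    E.≋-trans eq (E.≋-trans
      (just (injective {B} {B′} (Pc.≋-trans {ι B} {ι A Pc.+⟨ p ⟩ C} {ι B′} B≋
        (Pc.≋-sym {ι B′} {ι A Pc.+⟨ p ⟩ C} B′≋))))
      (E.≋-sym eq′))
    where
    module E = OnePointExtension E

  binary-determined : ∀ E F {C s t} {Q : Pred X.Carrier s} {N : Pred X.Carrier t} →
    (∀ {A} → ¬ A ∈ Q → A ∈ N) →
    ImitatesOn E C Q → (∀ {A} → A ∈ N → AdheresTo* E A) →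
    ImitatesOn F C Q → (∀ {A} → A ∈ N → AdheresTo* F A) →
    E ≈ᴱ F
  binary-determined E F {C} {Q = Q} dichotomy imitates adheres imitates′ adheres′ = XE.≈ᴱ-from-binary E F agree
    where
    module E = OnePointExtension E
    agree : ∀ A p → XE.AgreeAt E F A p
    agree A p with em _ {A ∈ Q}
    ... | yes A∈Q = imitations-agree E F {C} {Q = Q} {Q} imitates imitates′ A∈Q A∈Q p
    ... | no A∉Q  = E.≋-trans (adheres (dichotomy A∉Q) p) (E.≋-sym (adheres′ (dichotomy A∉Q) p))

  imitated⇒nonadherent : ∀ E {C s} {Q : Pred X.Carrier s} → ImitatesOn E C Q → ∀ {A} → A ∈ Q → ¬ AdheresTo* E A
  imitated⇒nonadherent E imitates A∈Q adh = let B , eq , _ = imitates A∈Q ½ in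
    XE.real≉* E (E.≋-trans (E.≋-sym eq) (adh ½))
    where
    module E = OnePointExtension E

  point : ∀ {v} → v ∈ pred D → X.Carrier
  point {v} v∈D = proj₁ (realize (｛_｝ 𝕍 v) (λ x≋v → resp D (𝕍.≋-sym x≋v) v∈D))

  point≋ : ∀ {v} (v∈D : v ∈ pred D) → ι (point v∈D) Pc.≋ ｛_｝ 𝕍 v
  point≋ {v} v∈D = proj₂ (realize (｛_｝ 𝕍 v) (λ x≋v → resp D (𝕍.≋-sym x≋v) v∈D))

  -- A single common singleton {v} suffices: ½{v} + ½* has both descriptions, and {v} cancels.
  imitated-set-unique : ∀ E {C C′ s s′} {Q : Pred X.Carrier s} {Q′ : Pred X.Carrier s′} →
    ImitatesOn E C Q → ImitatesOn E C′ Q′ → ∀ {v} (v∈D : v ∈ pred D) → point v∈D ∈ Q → point v∈D ∈ Q′ → C Pc.≋ C′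
  imitated-set-unique E {C} {C′} imitates imitates′ {v} v∈D ∈Q ∈Q′ =
    let B , eq , B≋ = imitates ∈Q ½ ; B′ , eq′ , B′≋ = imitates′ ∈Q′ ½ in
    singleton-cancel ½ {v} {C} {C′}
      (Pc.≋-trans {⟨v⟩ Pc.+⟨ ½ ⟩ C} {ι A Pc.+⟨ ½ ⟩ C} {⟨v⟩ Pc.+⟨ ½ ⟩ C′}
        (Pc.≋-sym {ι A Pc.+⟨ ½ ⟩ C} {⟨v⟩ Pc.+⟨ ½ ⟩ C} (A-mix C))
      (Pc.≋-trans {ι A Pc.+⟨ ½ ⟩ C} {ι B} {⟨v⟩ Pc.+⟨ ½ ⟩ C′} (Pc.≋-sym {ι B} {ι A Pc.+⟨ ½ ⟩ C} B≋)
      (Pc.≋-trans {ι B} {ι B′} {⟨v⟩ Pc.+⟨ ½ ⟩ C′} (just-injective E (E.≋-trans (E.≋-sym eq) eq′))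
      (Pc.≋-trans {ι B′} {ι A Pc.+⟨ ½ ⟩ C′} {⟨v⟩ Pc.+⟨ ½ ⟩ C′} B′≋ (A-mix C′)))))
    where
    module E = OnePointExtension E
    A : X.Carrier
    A = point v∈D
    ⟨v⟩ : ConvexSet 𝕍
    ⟨v⟩ = ｛_｝ 𝕍 v
    A-mix : ∀ C → ι A Pc.+⟨ ½ ⟩ C Pc.≋ ⟨v⟩ Pc.+⟨ ½ ⟩ C
    A-mix C = Pc.+⟨⟩-cong {ι A} {⟨v⟩} {C} {C} ½ (point≋ v∈D) (Pc.≋-refl {C})

  -- Classification when D contains no ray.

  module _ (D-large : MoreThanOne 𝕍 (pred D))
           (no-ray : ∀ b v → (∀ {t} → 0# < t → b +ᴹ t *ₗ v ∈ pred D) → v ≈ᴹ 0ᴹ) where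

    -- As C is a cone with apex a, a point c of C other than a would give a ray in D from px +
    -- (1-p)a in the direction (1-p)(c - a).
    adherent-singleton : ∀ {a C} p x → Pc.Adheres (｛_｝ 𝕍 a) C →
      (∀ {c} → c ∈ elements C → x 𝕍.+⟨ p ⟩ c ∈ pred D) → ∀ {c} → c ∈ elements C → c 𝕍.≋ a
    adherent-singleton {a} {C} p x adh into-D {c} c∈C =
      difference≈0⇒≈ (*ₗ-cancel (0< (∁ p)) (𝕍.≋-trans (no-ray (x 𝕍.+⟨ p ⟩ a) _ ray) (𝕍.≋-sym (Module.*ₗ-zeroʳ V _))))
      where
      v : Carrierᴹ
      v = c +ᴹ -ᴹ a
      ray : ∀ {t} → 0# < t → (x 𝕍.+⟨ p ⟩ a) +ᴹ t *ₗ (value (∁ p) *ₗ v) ∈ pred D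
      ray {t} 0<t = resp D (𝕍.≋-trans (+⟨⟩-shiftʳ p) (Module.+ᴹ-congˡ V (*ₗ-swap _ t v)))
        (into-D (cone em C adh c∈C 0<t))

    Adheres-resp : ∀ {A B C} → A Pc.≋ B → Pc.Adheres A C → Pc.Adheres B C
    Adheres-resp {A} {B} {C} A≋B adh p = Pc.≋-trans {B Pc.+⟨ p ⟩ C} {A Pc.+⟨ p ⟩ C} {C}
      (Pc.+⟨⟩-cong {B} {A} {C} {C} p (Pc.≋-sym {A} {B} A≋B) (Pc.≋-refl {C})) (adh p)

    -- Visibility puts ½a + ½C inside D, so adherence would force C = {a}. Hence the prime ideal in
    -- a prescription of the fourth kind contains every singleton.
    large⇒points-nonadherent : ∀ {a C} (a∈D : a ∈ pred D) → elements C ⊆ Vis 𝕍 (pred D) → MoreThanOne 𝕍 (elements C) →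
      ¬ Pc.Adheres (ι (point a∈D)) C
    large⇒points-nonadherent {a} {C} a∈D C⊆Vis (x , y , x∈C , y∈C , x≉y) adh =
      x≉y (𝕍.≋-trans (≋a x∈C) (𝕍.≋-sym (≋a y∈C)))
      where
      ≋a : ∀ {c} → c ∈ elements C → c 𝕍.≋ a
      ≋a = adherent-singleton {a} {C} ½ a (Adheres-resp {ι (point a∈D)} {｛_｝ 𝕍 a} {C} (point≋ a∈D) adh)
        λ c∈C → resp D (𝕍.≋-trans (𝕍.+⟨⟩-comm (∁ ½)) (𝕍.+⟨⟩-weight {∁ (∁ ½)} {½} (1-[1-x]≈x _))) (C⊆Vis c∈C a∈D (∁ ½))

    -- In the prime case the ideal is not stored, since it has to be the set of elements not
    -- adhering to *. The condition I ⊆ P appears contrapositively: whatever adheres to * adheres to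
    -- C.
    data Classification (E : OnePointExtension X) : Set (lsuc ℓ ⊔ c ⊔ e) where
      blackHole : (∀ A → AdheresTo* E A) → Classification E
      imitate   : ∀ C → elements C ⊆ Vis 𝕍 (pred D) → ImitatesOn E C U → Classification E
      extremal  : ∀ {v} → v ∈ pred D → ExtremalIn-D v → ImitatesOn E (｛_｝ 𝕍 v) (λ A → ¬ ι A Pc.≋ ｛_｝ 𝕍 v) →
                  (∀ {A} → ι A Pc.≋ ｛_｝ 𝕍 v → AdheresTo* E A) → Classification E
      prime     : ∀ C → elements C ⊆ Vis 𝕍 (pred D) → MoreThanOne 𝕍 (elements C) →
                  (∀ {A} → AdheresTo* E A → Pc.Adheres (ι A) C) → ¬ (∀ A → ¬ AdheresTo* E A) →
                  ImitatesOn E C (λ A → ¬ AdheresTo* E A) → Classification E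

    module _ (E : OnePointExtension X) where
      open OnePointExtension E

      private
        P : Subset X.carrier (ℓ ⊔ c ⊔ e)
        P = XE.NonAdherent E em

      -- If all points of D adhere to *, then p A + (1 - p) * is invariant under the
      -- translations in the directions of D - D.
      nonadherent⇒some-point : ∀ {A} → A ∈ pred P → ∃ λ v → ∃ λ (v∈D : v ∈ pred D) → point v∈D ∈ pred P
      nonadherent⇒some-point {A} A∈P with em _ {∃ λ v → ∃ λ (v∈D : v ∈ pred D) → point v∈D ∈ pred P}
      ... | yes found = found
      ... | no none = let x , y , x∈D , y∈D , x≉y = D-large in
        let b , b∈B = nonempty (ι B) in
        contradiction (𝕍.≋-sym (difference≈0⇒≈ (no-ray b (y +ᴹ -ᴹ x) (λ 0<t → ι⊆D B
          (translation em {ι A} {x} {y} ½ {ι (A X.+⟨ ½ ⟩ point x∈D)} {ι (A X.+⟨ ½ ⟩ point y∈D)} (ι B)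
            (mixture x∈D) (mixture y∈D) (adheres-B x∈D) (adheres-B y∈D) 0<t b∈B))))) x≉y
        where
        B : X.Carrier
        B = proj₁ (XE.real-combination E em A∈P ½)
        mixture : ∀ {v} (v∈D : v ∈ pred D) → ι (A X.+⟨ ½ ⟩ point v∈D) Pc.≋ ι A Pc.+⟨ ½ ⟩ ｛_｝ 𝕍 v
        mixture {v} v∈D = Pc.≋-trans {ι (A X.+⟨ ½ ⟩ point v∈D)} {ι A Pc.+⟨ ½ ⟩ ι (point v∈D)} {ι A Pc.+⟨ ½ ⟩ ｛_｝ 𝕍 v}
          (ι-binary A (point v∈D) ½)
          (Pc.+⟨⟩-cong {ι A} {ι A} {ι (point v∈D)} {｛_｝ 𝕍 v} ½ (Pc.≋-refl {ι A}) (point≋ v∈D))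
        adheres-B : ∀ {v} (v∈D : v ∈ pred D) → Pc.Adheres (ι (A X.+⟨ ½ ⟩ point v∈D)) (ι B)
        adheres-B v∈D q = Pc.≋-trans {ι Aᵥ Pc.+⟨ q ⟩ ι B} {ι (Aᵥ X.+⟨ q ⟩ B)} {ι B}
          (Pc.≋-sym {ι (Aᵥ X.+⟨ q ⟩ B)} {ι Aᵥ Pc.+⟨ q ⟩ ι B} (ι-binary Aᵥ B q))
          (ι-cong (XE.adherent-mixture E ½ q (proj₂ (XE.real-combination E em A∈P ½))
            (stable (λ ¬adh → none (_ , v∈D , ¬adh)))))
          where
          Aᵥ : X.Carrier
          Aᵥ = A X.+⟨ ½ ⟩ point v∈D

      module WithPoint {z} (z∈D : z ∈ pred D) (z∈P : point z∈D ∈ pred P) where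

        private
          Z F : X.Carrier
          Z = point z∈D
          F = proj₁ (XE.real-combination E em z∈P ½)

          ⟨z⟩ : ConvexSet 𝕍
          ⟨z⟩ = ｛_｝ 𝕍 z

        C : ConvexSet 𝕍
        C = quotient ½ z (ι F)

        private
          Z-mix : ∀ B → ι Z Pc.+⟨ ½ ⟩ B Pc.≋ ⟨z⟩ Pc.+⟨ ½ ⟩ B
          Z-mix B = Pc.+⟨⟩-cong {ι Z} {⟨z⟩} {B} {B} ½ (point≋ z∈D) (Pc.≋-refl {B})

          Z-cancel : ∀ {A B} → ι Z Pc.+⟨ ½ ⟩ A Pc.≋ ι Z Pc.+⟨ ½ ⟩ B → A Pc.≋ B
          Z-cancel {A} {B} eq = singleton-cancel ½ {z} {A} {B}
            (Pc.≋-trans {⟨z⟩ Pc.+⟨ ½ ⟩ A} {ι Z Pc.+⟨ ½ ⟩ A} {⟨z⟩ Pc.+⟨ ½ ⟩ B}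
              (Pc.≋-sym {ι Z Pc.+⟨ ½ ⟩ A} {⟨z⟩ Pc.+⟨ ½ ⟩ A} (Z-mix A))
            (Pc.≋-trans {ι Z Pc.+⟨ ½ ⟩ A} {ι Z Pc.+⟨ ½ ⟩ B} {⟨z⟩ Pc.+⟨ ½ ⟩ B} eq (Z-mix B)))

          F≋Z+C : ι F Pc.≋ ι Z Pc.+⟨ ½ ⟩ C
          F≋Z+C = Pc.≋-trans {ι F} {⟨z⟩ Pc.+⟨ ½ ⟩ C} {ι Z Pc.+⟨ ½ ⟩ C} (quotient-mix ½ z (ι F))
            (Pc.≋-sym {ι Z Pc.+⟨ ½ ⟩ C} {⟨z⟩ Pc.+⟨ ½ ⟩ C} (Z-mix C))

          module Im = Imitation R embedding E

        imitates-C : ImitatesOn E C (pred P)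
        imitates-C {A} A∈P p = let B , eq = XE.real-combination E em A∈P p in
          B , eq , Im.imitated Z (λ {A} {B} → Z-cancel {A} {B})
            (proj₂ (XE.real-combination E em z∈P ½)) {C} F≋Z+C {A} {B} {p} eq

        adheres-C : ∀ {A} → Adheres (just A) nothing → Pc.Adheres (ι A) C
        adheres-C {A} = Im.adherent⇒adheres Z (λ {A} {B} → Z-cancel {A} {B})
          (proj₂ (XE.real-combination E em z∈P ½)) {C} F≋Z+C {A}

        adherent-point : ∀ {a} (a∈D : a ∈ pred D) → Adheres (just (point a∈D)) nothing →
                         ∀ {c} → c ∈ elements C → c 𝕍.≋ a
        -- By construction of C, membership of c means that the midpoint of z and c lies in F, hence
        -- in D.
        adherent-point {a} a∈D adh = adherent-singleton {a} {C} ½ z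
          (Adheres-resp {ι (point a∈D)} {｛_｝ 𝕍 a} {C} (point≋ a∈D) (adheres-C adh)) (ι⊆D F)

        adheres-singleton : ∀ {A a} → C Pc.≋ ｛_｝ 𝕍 a → Adheres (just A) nothing → ι A Pc.≋ ｛_｝ 𝕍 a
        adheres-singleton {A} {a} C≋ adh = ⊆singleton⇒≋ (ι A) λ {x} x∈A →
          let c , c∈C = nonempty C ; c≋a = proj₁ C≋ c∈C
              x+c∈C = proj₁ (adheres-C adh ½) (+⟨⟩-∈⁺ {ι A} {C} {½} x∈A c∈C)
              x+a≋a = 𝕍.≋-trans (𝕍.+⟨⟩-cong ½ 𝕍.≋-refl (𝕍.≋-sym c≋a)) (proj₁ C≋ x+c∈C)
          in +⟨⟩-cancelˡ (∁ ½) (𝕍.≋-trans (𝕍.≋-sym (𝕍.+⟨⟩-comm ½))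
               (𝕍.≋-trans x+a≋a (𝕍.≋-sym (𝕍.+⟨⟩-idem {∁ ½} a))))

        extremal-case : ∀ {a} (a∈D : a ∈ pred D) → Adheres (just (point a∈D)) nothing → Classification E
        extremal-case {a} a∈D adh = extremal a∈D extreme imitates λ A≋a → adh-resp A≋a
          where
          ⟨a⟩ : ConvexSet 𝕍
          ⟨a⟩ = ｛_｝ 𝕍 a
          C≋a : C Pc.≋ ⟨a⟩
          C≋a = ⊆singleton⇒≋ C (adherent-point a∈D adh)
          adh-resp : ∀ {A} → ι A Pc.≋ ⟨a⟩ → Adheres (just A) nothing
          adh-resp {A} A≋a p = ≋-trans (+⟨⟩-cong p (just (injective {A} {point a∈D}
            (Pc.≋-trans {ι A} {⟨a⟩} {ι (point a∈D)} A≋a (Pc.≋-sym {ι (point a∈D)} {⟨a⟩} (point≋ a∈D))))) ≋-refl) (adh p)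
          imitates : ImitatesOn E ⟨a⟩ (λ A → ¬ ι A Pc.≋ ⟨a⟩)
          imitates {A} A≉a p =
            let B , eq , B≋ = imitates-C {A} (λ adh-A → A≉a (adheres-singleton {A} C≋a adh-A)) p in
            B , eq , Pc.≋-trans {ι B} {ι A Pc.+⟨ p ⟩ C} {ι A Pc.+⟨ p ⟩ ⟨a⟩} B≋
              (Pc.+⟨⟩-cong {ι A} {ι A} {C} {⟨a⟩} p (Pc.≋-refl {ι A}) C≋a)
          -- If {x} adhered to *, then C would be both {x} and {a}. So for x different from a the
          -- set {x} is in the ideal P, and with it p{x} + (1-p){y} = {a}, which adheres to *.
          left-equal : ∀ x y p → x ∈ pred D → y ∈ pred D → x 𝕍.+⟨ p ⟩ y 𝕍.≋ a → x 𝕍.≋ a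
          left-equal x y p x∈D y∈D x+y≋a = stable λ x≉a →
            proj₁ (XE.NonAdherent-prime E em) {point x∈D} {point y∈D} p
              (λ adh-x → let c , c∈C = nonempty C in
                x≉a (𝕍.≋-trans (𝕍.≋-sym (adherent-point x∈D adh-x c∈C)) (adherent-point a∈D adh c∈C)))
              (adh-resp {point x∈D X.+⟨ p ⟩ point y∈D} (⊆singleton⇒≋ (ι (point x∈D X.+⟨ p ⟩ point y∈D)) λ v∈ →
                let x′ , y′ , x′∈ , y′∈ , v≋ = +⟨⟩-∈⁻ {ι (point x∈D)} {ι (point y∈D)} {p}
                                                 (proj₁ (ι-binary (point x∈D) (point y∈D) p) v∈)
                in 𝕍.≋-trans v≋ (𝕍.≋-trans
                     (𝕍.+⟨⟩-cong p (proj₁ (point≋ x∈D) x′∈) (proj₁ (point≋ y∈D) y′∈)) x+y≋a)))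
          extreme : ExtremalIn-D a
          extreme x y p x∈D y∈D x+y≋a =
            left-equal x y p x∈D y∈D x+y≋a ,
            left-equal y x (∁ p) y∈D x∈D (𝕍.≋-trans (𝕍.≋-sym (𝕍.+⟨⟩-comm p)) x+y≋a)

        module _ (points : ∀ {a} (a∈D : a ∈ pred D) → point a∈D ∈ pred P) where

          C⊆Vis : elements C ⊆ Vis 𝕍 (pred D)
          C⊆Vis {x} x∈C {d} d∈D p = let B , _ , B≋ = imitates-C {point d∈D} (points d∈D) (∁ p) in
            resp D (𝕍.≋-sym (𝕍.+⟨⟩-comm p)) (ι⊆D B (proj₂ B≋
              (+⟨⟩-∈⁺ {ι (point d∈D)} {C} {∁ p} (proj₂ (point≋ d∈D) 𝕍.≋-refl) x∈C)))

          -- If C were {c}, the adhering set A would be {c} as well. Then c lies in D, and {c} is an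
          -- adhering singleton, against `points`.
          C-large : ∀ {A} → Adheres (just A) nothing → MoreThanOne 𝕍 (elements C)
          C-large {A} adh = stable λ ¬large →
            let c , c∈C = nonempty C
                C≋c = ⊆singleton⇒≋ {c} C (λ {x} x∈C → stable (λ x≉c → ¬large (x , c , x∈C , c∈C , x≉c)))
                A≋c = adheres-singleton {A} C≋c adh
                a , a∈A = nonempty (ι A)
                c∈D = resp D (proj₁ A≋c a∈A) (ι⊆D A a∈A)
            in points c∈D (λ p → ≋-trans (+⟨⟩-cong p (just (injective {point c∈D} {A}
                 (Pc.≋-trans {ι (point c∈D)} {｛_｝ 𝕍 c} {ι A} (point≋ c∈D) (Pc.≋-sym {ι A} {｛_｝ 𝕍 c} A≋c)))) ≋-refl) (adh p))

      classify : Classification E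
      classify with em _ {∃ λ v → ∃ λ (v∈D : v ∈ pred D) → point v∈D ∈ pred P}
      ... | no none = blackHole (λ A → stable λ ¬adh → none (nonadherent⇒some-point {A} ¬adh))
      ... | yes (z , z∈D , z∈P) with em _ {∃ λ a → ∃ λ (a∈D : a ∈ pred D) → Adheres (just (point a∈D)) nothing}
      ...   | yes (a , a∈D , adh) = WithPoint.extremal-case z∈D z∈P a∈D adh
      ...   | no none with em _ {∃ λ A → Adheres (just A) nothing}
      ...     | no none′ = imitate W.C (W.C⊆Vis points) (λ {A} _ → W.imitates-C {A} (λ adh → none′ (A , adh)))
        where
        module W = WithPoint z∈D z∈P
        points : ∀ {a} (a∈D : a ∈ pred D) → point a∈D ∈ pred P
        points a∈D adh = none (_ , a∈D , adh)
      ...     | yes (A , adh) = prime W.C (W.C⊆Vis points) (W.C-large points {A} adh) (λ {A} → W.adheres-C {A})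
          (λ all → all A adh) (λ {A} → W.imitates-C {A})
        where
        module W = WithPoint z∈D z∈P
        points : ∀ {a} (a∈D : a ∈ pred D) → point a∈D ∈ pred P
        points a∈D adh = none (_ , a∈D , adh)

-- Transfer to 𝒫_c 𝔻 and separation of the cases.

module Prescriptions {ℓ} (em : ∀ a → ExcludedMiddle a) (R : CompleteOrderedField ℓ) (V : VectorSpace R)
    (D : Subset (Module.≈ᴹ-setoid V) ℓ)
    (D-convex : Convexity.IsConvex R (Convexity.vectorAlgebra R V) D) where
  open Convexity R
  open Extensions R V D D-convex
  open ConvexSetProperties R V using (everything)

  module S = Representation em R V D D-convex 𝕏 proj₁ (λ e → e) (λ e → e)
     (λ p A → (λ x → x) , (λ x → x)) proj₂ (λ B B⊆D → (B , B⊆D) , (λ x → x) , (λ x → x))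
  private
    module 𝕍 = ConvexAlgebra 𝕍
    module 𝕏 = ConvexAlgebra 𝕏
    module XE = ExtensionProperties R 𝕏

  extremal-in-D : ∀ (v : ∃ (pred D)) → Extremal 𝔻 v → S.ExtremalIn-D (proj₁ v)
  extremal-in-D v ext x y p x∈D y∈D x+y≈v =
    ext (x , x∈D) (y , y∈D) p (𝕍.≋-trans (𝕍.comb-binary p (λ i → proj₁ (pair (x , x∈D) (y , y∈D) i))) x+y≈v)

  construct : (π : Prescription) → ∃ λ (E : OnePointExtension 𝕏) → Realizes E π
  construct blackHole          = S.blackHole-extension
  construct (imitate C C⊆Vis)  = S.imitate-extension C C⊆Vis
  construct (extremal v ext)   = let E , imitates , adheres = S.extremal-extension (proj₂ v) (extremal-in-D v ext) in
    E , (λ {A} → imitates {A}) , adheres {⟪ v ⟫} ((λ x → x) , (λ x → x))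
  construct (prime d)          = S.prime-extension (PrimeCase.P d) (PrimeCase.P-prime d) (PrimeCase.C d) (PrimeCase.C⊆Vis d)
    -- Only the generators of I matter: a set that does not adhere to C lies in I, hence in P.
    (λ {A} A∉P p → S.stable (λ ¬adh → A∉P (PrimeCase.I⊆P d (incl {x = A} (λ adh → ¬adh (adh p))))))

  determined : (π : Prescription) (E F : OnePointExtension 𝕏) → Realizes E π → Realizes F π → E ≈ᴱ F
  determined blackHole E F r r′ = S.binary-determined E F {everything} {Q = λ _ → ⊥} {U} (λ _ → tt)
    (λ ()) (λ {A} _ → r A) (λ ()) (λ {A} _ → r′ A)
  determined (imitate C _) E F r r′ = S.binary-determined E F {C} {Q = U} {λ _ → ⊥} (λ A∉U → A∉U tt)
    (λ {A} → r {A}) (λ ()) (λ {A} → r′ {A}) (λ ())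
  determined (extremal v _) E F (im , adh) (im′ , adh′) =
    S.binary-determined E F {proj₁ ⟪ v ⟫} {N = λ A → A 𝕏.≋ ⟪ v ⟫} S.stable
      (λ {A} → im {A}) (λ {A} A≋v → XE.adheres-resp E {⟪ v ⟫} {A} (𝕏.≋-sym {A} {⟪ v ⟫} A≋v) adh)
      (λ {A} → im′ {A}) (λ {A} A≋v → XE.adheres-resp F {⟪ v ⟫} {A} (𝕏.≋-sym {A} {⟪ v ⟫} A≋v) adh′)
  determined (prime d) E F (im , adh) (im′ , adh′) =
    S.binary-determined E F {PrimeCase.C d} {Q = pred (PrimeCase.P d)} {λ A → ¬ pred (PrimeCase.P d) A} (λ A∉P → A∉P)
      (λ {A} → im {A}) (λ {A} → adh {A}) (λ {A} → im′ {A}) (λ {A} → adh′ {A})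

  module _ (D-large : MoreThanOne 𝕍 (pred D)) (bounded : LinearlyBounded D-D) where
    open CompleteOrderedField R using (0#; 1#; _+_; _<_; 0<1)
    open OrderedField R using (0<+; 0<1+1)
    open VectorProperties R V using (ray-difference; doubling-fixed⇒0)
    open Module V using (_≈ᴹ_; _+ᴹ_; _*ₗ_; 0ᴹ; *ₗ-congʳ)

    -- A ray in direction v makes s ↦ sv a homomorphism from (0,∞) to D - D. It is constant, and its
    -- values at 1 and 2 give v = 2v.
    no-ray : ∀ b v → (∀ {t} → 0# < t → b +ᴹ t *ₗ v ∈ pred D) → v ≈ᴹ 0ᴹ
    no-ray b v ray = doubling-fixed⇒0 v (bounded scaling (1# , 0<1) (1# + 1# , 0<1+1))
      where
      scaling : Homomorphism ℝ⁺ D-D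
      scaling = record
        { map      = λ (s , 0<s) → s *ₗ v ,
            _ , _ , ray (0<+ 0<s 0<1) , ray 0<1 , ray-difference b s v
        ; map-cong = *ₗ-congʳ
        ; map-comb = λ p x → Homomorphism.map-comb (VectorProperties.scale R V v) p x
        }

    prescribe : ∀ {E} → S.Classification D-large no-ray E → ∃ λ π → Realizes E π
    prescribe (S.blackHole adheres)         = blackHole , adheres
    prescribe (S.imitate C C⊆Vis imitates)  = imitate C C⊆Vis , λ {A} → imitates {A}
    prescribe (S.extremal v∈D extreme imitates adheres) =
      extremal (_ , v∈D) (λ (x , x∈D) (y , y∈D) p eq → extreme x y p x∈D y∈D
        (𝕍.≋-trans (𝕍.≋-sym (𝕍.comb-binary p (λ i → proj₁ (pair (x , x∈D) (y , y∈D) i)))) eq)) ,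
      (λ {A} → imitates {A}) , adheres ((λ x → x) , (λ x → x))
    prescribe {E} (S.prime C C⊆Vis large adheres ¬all imitates) =
      prime (record
        { C = C ; C⊆Vis = C⊆Vis ; C-large = large
        ; I≢X = λ all → ¬all (λ A → I⊆P (all A))
        ; P = XE.NonAdherent E em ; P-prime = XE.NonAdherent-prime E em
        ; P≢X = ¬all ; I⊆P = I⊆P
        }) ,
      (λ {A} → imitates {A}) , λ {A} A∉P → S.stable A∉P
      where
      -- An ideal is convex, so only the generators of the hull need checking.
      I⊆P : ∀ {A} → A ∈ I C → ¬ AdheresTo* E A
      I⊆P = AlgebraProperties.Conv-least R 𝕏 (XE.NonAdherent E em)
        (λ {A} {B} p A∈P _ → proj₁ (XE.NonAdherent-prime E em) {A} {B} p A∈P)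
        (λ {A} ¬adh adh → ¬adh (adheres {A} adh))

    other-than : ∀ v → ∃ λ x → x ∈ pred D × ¬ x 𝕍.≋ v
    other-than v with em _ {proj₁ D-large 𝕍.≋ v}
    ... | no x≉v  = let x , _ , x∈D , _ = D-large in x , x∈D , x≉v
    ... | yes x≈v = let _ , y , _ , y∈D , x≉y = D-large in
      y , y∈D , λ y≈v → x≉y (𝕍.≋-trans x≈v (𝕍.≋-sym y≈v))

    module _ (E : OnePointExtension 𝕏) where
      private
        d∈D : proj₁ D-large ∈ pred D
        d∈D = proj₁ (proj₂ (proj₂ D-large))

      imitate⇒nonadherent : ∀ C (s : C ⊆Vis) → Realizes E (imitate C s) → ∀ A → ¬ AdheresTo* E A
      imitate⇒nonadherent C _ imitates A = S.imitated⇒nonadherent E {C} {Q = U} (λ {A} → imitates {A}) {A} tt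

      extremal⇒nonadherent : ∀ v e → Realizes E (extremal v e) → ∀ {x} (x∈D : x ∈ pred D) → ¬ x 𝕍.≋ proj₁ v →
                             ¬ AdheresTo* E (S.point x∈D)
      extremal⇒nonadherent v _ (imitates , _) x∈D x≉v =
        S.imitated⇒nonadherent E {proj₁ ⟪ v ⟫} {Q = λ A → ¬ A 𝕏.≋ ⟪ v ⟫} (λ {A} → imitates {A}) {S.point x∈D}
          (λ (x⊆v , _) → x≉v (x⊆v 𝕍.≋-refl))

      point∈P : ∀ d {x} (x∈D : x ∈ pred D) → S.point x∈D ∈ pred (PrimeCase.P d)
      point∈P d x∈D = PrimeCase.I⊆P d (incl {x = S.point x∈D}
        (S.large⇒points-nonadherent D-large no-ray x∈D (PrimeCase.C⊆Vis d) (PrimeCase.C-large d)))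

      prime⇒nonadherent : ∀ d → Realizes E (prime d) → ∀ {x} (x∈D : x ∈ pred D) → ¬ AdheresTo* E (S.point x∈D)
      prime⇒nonadherent d (imitates , _) x∈D =
        S.imitated⇒nonadherent E {PrimeCase.C d} {Q = pred (PrimeCase.P d)} (λ {A} → imitates {A}) {S.point x∈D} (point∈P d x∈D)

      prime⇒some-adherent : ∀ d → Realizes E (prime d) → ∃ λ A → AdheresTo* E A
      prime⇒some-adherent d (_ , adheres) = S.stable λ none →
        PrimeCase.P≢X d (λ A → S.stable (λ A∉P → none (A , adheres {A} A∉P)))

      prime-P⊆ : ∀ d d′ → Realizes E (prime d) → Realizes E (prime d′) → pred (PrimeCase.P d) ⊆ pred (PrimeCase.P d′)
      prime-P⊆ d d′ (imitates , _) (_ , adheres′) {A} A∈P = S.stable λ A∉P′ →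
        S.imitated⇒nonadherent E {PrimeCase.C d} {Q = pred (PrimeCase.P d)} (λ {A} → imitates {A}) {A} A∈P (adheres′ {A} A∉P′)

      -- The sets adhering to * tell the cases apart: all of X for the black hole, none for
      -- imitation on X, {v} but no other singleton in the extremal case, and some set but no
      -- singleton in the prime case. Within the prime case they also determine P.
      prescription-unique : ∀ π π′ → Realizes E π → Realizes E π′ → π ≈ᴾ π′
      prescription-unique blackHole blackHole _ _ = blackHole
      prescription-unique blackHole (imitate C s) r r′ = contradiction (r _) (imitate⇒nonadherent C s r′ (S.point d∈D))
      prescription-unique blackHole (extremal v e) r r′ = let x , x∈D , x≉v = other-than (proj₁ v) in
        contradiction (r _) (extremal⇒nonadherent v e r′ x∈D x≉v)
      prescription-unique blackHole (prime d) r r′ = contradiction (r _) (prime⇒nonadherent d r′ d∈D)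
      prescription-unique (imitate C s) blackHole r r′ = contradiction (r′ _) (imitate⇒nonadherent C s r (S.point d∈D))
      prescription-unique (imitate C _) (imitate C′ _) r r′ =
        imitate (S.imitated-set-unique E {C} {C′} {Q = U} {U} (λ {A} → r {A}) (λ {A} → r′ {A}) d∈D tt tt)
      prescription-unique (imitate C s) (extremal v e) r (_ , adh) = contradiction adh (imitate⇒nonadherent C s r ⟪ v ⟫)
      prescription-unique (imitate C s) (prime d) r r′ = let A , adh = prime⇒some-adherent d r′ in
        contradiction adh (imitate⇒nonadherent C s r A)
      prescription-unique (extremal v e) blackHole r r′ = let x , x∈D , x≉v = other-than (proj₁ v) in
        contradiction (r′ _) (extremal⇒nonadherent v e r x∈D x≉v)
      prescription-unique (extremal v e) (imitate C s) (_ , adh) r′ = contradiction adh (imitate⇒nonadherent C s r′ ⟪ v ⟫)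
      prescription-unique (extremal v e) (extremal v′ e′) (_ , adh) r′ =
        extremal (S.stable λ v≉v′ → extremal⇒nonadherent v′ e′ r′ (proj₂ v) v≉v′ adh)
      prescription-unique (extremal v e) (prime d) (_ , adh) r′ = contradiction adh (prime⇒nonadherent d r′ (proj₂ v))
      prescription-unique (prime d) blackHole r r′ = contradiction (r′ _) (prime⇒nonadherent d r d∈D)
      prescription-unique (prime d) (imitate C s) r r′ = let A , adh = prime⇒some-adherent d r in
        contradiction adh (imitate⇒nonadherent C s r′ A)
      prescription-unique (prime d) (extremal v e) r (_ , adh) = contradiction adh (prime⇒nonadherent d r (proj₂ v))
      prescription-unique (prime d) (prime d′) r@(im , _) r′@(im′ , _) = prime
        (S.imitated-set-unique E {PrimeCase.C d} {PrimeCase.C d′} {Q = pred (PrimeCase.P d)} {pred (PrimeCase.P d′)}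
          (λ {A} → im {A}) (λ {A} → im′ {A}) d∈D (point∈P d d∈D) (point∈P d′ d∈D))
        ((λ {A} → prime-P⊆ d d′ r r′ {A}) , (λ {A} → prime-P⊆ d′ d r′ r {A}))

theorem6p11 : ∀ {ℓ} → (∀ a → ExcludedMiddle a) →
    (R : CompleteOrderedField ℓ) (V : VectorSpace R) →
    let open Convexity R in
    (D : Subset (Module.≈ᴹ-setoid V) ℓ) (D-convex : IsConvex (vectorAlgebra V) D) →
    MoreThanOne (vectorAlgebra V) (pred D) →
    let open Extensions R V D D-convex in
    (∀ π → ∃! _≈ᴱ_ (λ E → Realizes E π)) ×
    (LinearlyBounded D-D → ∀ E → ∃! _≈ᴾ_ (λ π → Realizes E π))
theorem6p11 em R V D D-convex D-large =
  (λ π → let E , r = F.construct π in E , r , λ {E′} r′ → F.determined π E E′ r r′) ,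
  (λ bounded E →
    let π , r = F.prescribe D-large bounded (F.S.classify D-large (F.no-ray D-large bounded) E)
    in π , r , λ {π′} r′ → F.prescription-unique D-large bounded E π π′ r r′)
  where
  module F = Prescriptions em R V D D-convex
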